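{- Let $G$ be a finite, simple, connected $K_{1,4}$-free graph. If $\sigma_{7}(G) \geq |G|$, then $G$ has a spanning tree whose reducible stem is a path.
   Context: All graphs are finite and simple; $|G|$ denotes the number of vertices of $G$ and $\deg_G(v)$ the degree of $v$ in $G$. A graph is $K_{1,4}$-free if it contains no induced subgraph isomorphic to the star $K_{1,4}$. For an integer $p\geq 2$, $\sigma_p(G)$ is the minimum of $\sum_{x\in S}\deg_G(x)$ over all independent sets $S\subseteq V(G)$ with $|S|=p$; by convention $\sigma_p(G)=+\infty$ if $G$ has no independent set of size $p$. For a tree $T$, a leaf is a vertex of degree one and a branch vertex is a vertex of degree at least three. For a leaf $x$ of $T$, let $y_x$ be the branch vertex of $T$ nearest to $x$, and let $P_T[x,y_x)$ be the path in $T$ from $x$ to $y_x$ not including $y_x$ (the leaf-branch path incident to $x$). The reducible stem of $T$ is the subtree obtained from $T$ by deleting $P_T[x,y_x)$ for every leaf $x$ of $T$; equivalently, it is the smallest subtree of $T$ containing all branch vertices of $T$. -}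

module Defs where

open import Data.Nat using (ℕ; zero; suc; _≤_)
open import Data.Bool using (Bool; true; false; if_then_else_)
open import Data.Fin using (Fin)
open import Data.List using (List; []; _∷_; length; map; allFin; head; last)
open import Data.Nat.ListAction using (sum)
open import Data.List.Membership.Propositional using (_∈_)
open import Data.List.Relation.Unary.Unique.Propositional using (Unique)
open import Data.Maybe using (just)
open import Data.Product using (_×_; Σ; ∃; ∃-syntax; _,_)
open import Data.Sum using (_⊎_)
open import Data.Unit using (⊤)
open import Relation.Nullary using (¬_)
open import Relation.Binary.PropositionalEquality using (_≡_; _≢_)
open import Function.Definitions using (Injective)

record Graph (n : ℕ) : Set where
  field
    adj   : Fin n → Fin n → Bool
    sym   : ∀ u v → adj u v ≡ adj v u
    irrefl : ∀ u → adj u u ≡ false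
open Graph public

deg : ∀ {n} → Graph n → Fin n → ℕ
deg {n} G u = sum (map (λ v → if adj G u v then 1 else 0) (allFin n))

Consec : ∀ {n} → Graph n → List (Fin n) → Set
Consec G []           = ⊤
Consec G (x ∷ [])     = ⊤
Consec G (x ∷ y ∷ xs) = (adj G x y ≡ true) × Consec G (y ∷ xs)

IsWalk : ∀ {n} → Graph n → Fin n → Fin n → List (Fin n) → Set
IsWalk G u v ws = Consec G ws × (head ws ≡ just u) × (last ws ≡ just v)

IsPath : ∀ {n} → Graph n → Fin n → Fin n → List (Fin n) → Set
IsPath G u v ps = IsWalk G u v ps × Unique ps

Connected : ∀ {n} → Graph n → Set
Connected G = ∀ u v → ∃[ ws ] IsWalk G u v ws

IsCycle : ∀ {n} → Graph n → List (Fin n) → Set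
IsCycle G cs = (3 ≤ length cs) × Unique cs × Consec G cs
             × ∃[ a ] ∃[ b ] (head cs ≡ just a × last cs ≡ just b × adj G b a ≡ true)

Acyclic : ∀ {n} → Graph n → Set
Acyclic G = ∀ cs → ¬ IsCycle G cs

IsTree : ∀ {n} → Graph n → Set
IsTree T = Connected T × Acyclic T

SubgraphOf : ∀ {n} → Graph n → Graph n → Set
SubgraphOf T G = ∀ u v → adj T u v ≡ true → adj G u v ≡ true

IsSpanningTree : ∀ {n} → Graph n → Graph n → Set
IsSpanningTree T G = SubgraphOf T G × IsTree T

K14Free : ∀ {n} → Graph n → Set
K14Free {n} G =
  ¬ (Σ (Fin n) λ c → Σ (Fin 4 → Fin n) λ f →
       Injective _≡_ _≡_ f
     × (∀ i → adj G c (f i) ≡ true)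
     × (∀ i j → adj G (f i) (f j) ≡ false))

IsIndependentSeq : ∀ {n} → Graph n → (p : ℕ) → (Fin p → Fin n) → Set
IsIndependentSeq G p f = Injective _≡_ _≡_ f × (∀ i j → adj G (f i) (f j) ≡ false)

-- σ_p(G) ≥ m : every independent set of size p has degree sum ≥ m
-- (vacuous when there is no such set, matching σ_p = +∞).
σ≥ : ∀ {n} → Graph n → (p m : ℕ) → Set
σ≥ G p m = ∀ f → IsIndependentSeq G p f → m ≤ sum (map (λ i → deg G (f i)) (allFin p))

IsBranch : ∀ {n} → Graph n → Fin n → Set
IsBranch T v = 3 ≤ deg T v

-- Vertex set of the reducible stem of a tree T (= smallest subtree
-- containing all branch vertices): vertices lying on the T-path between
-- two (not necessarily distinct) branch vertices.
InStem : ∀ {n} → Graph n → Fin n → Set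
InStem T v = ∃[ a ] ∃[ b ] ∃[ ps ]
  (IsBranch T a × IsBranch T b × IsPath T a b ps × v ∈ ps)

-- The reducible stem of T is a path: its vertices can be listed without
-- repetition, consecutive ones adjacent in T, the list containing exactly
-- the stem vertices.  (The empty list covers the case of an empty stem,
-- i.e. T without branch vertices, where T itself is a path.)
StemIsPath : ∀ {n} → Graph n → Set
StemIsPath {n} T = ∃[ ps ] (Unique ps × Consec T ps × (∀ v → (v ∈ ps → InStem T v) × (InStem T v → v ∈ ps)))

{-# OPTIONS --safe #-}

-- Take a spanning tree T minimising the excess Σ (deg v − 2)⁺, that is, the number of leaves. If u is
-- a leaf, xy a tree edge with u on the side of x, and u ~ y in G, then T − xy + uy shows that x has
-- degree 2 and no leaf other than u is adjacent to x. Charge an adjacency u ~ w to the last tree edge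
-- on the way from u to w. By the above and K₁,₄-freeness, no tree edge is charged by two leaves, so
-- the degrees of any set of leaves add up to less than n; seven leaves contradict σ₇ ≥ n.
--
-- With at most six leaves, either the stem is a path, or T has exactly four branch vertices: a centre
-- r of degree 3, with a branch vertex in each of the three directions. If r were adjacent to a leaf,
-- an exchange would give r degree 4, which with six leaves forces a path as stem. Further exchanges
-- show that no tree edge is charged both by r and by a leaf, so r and the six leaves contradict σ₇ ≥ n.

module Submission where

open import Defs renaming (sym to adj-sym)
open import Data.Bool using (Bool; true; false; if_then_else_; _∧_; _∨_; not)
open import Data.Bool.Properties using (∨-zeroʳ; ∨-identityʳ; ∧-identityʳ) renaming (_≟_ to _≟ᵇ_)
open import Data.Empty using (⊥; ⊥-elim)
open import Data.Fin using (Fin; zero; suc)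
open import Data.Fin.Properties using (_≟_)
open import Data.List using (List; []; _∷_; _++_; [_]; length; map; allFin; filter; head; last; reverse; tabulate; take; lookup; cartesianProduct)
open import Data.List.Properties using (map-tabulate; map-∘; map-cong; length-map; length-++; length-tabulate; unfold-reverse; reverse-++; ++-assoc; length-reverse; length-take; filter-++)
open import Data.List.Membership.Propositional using (_∈_; _∉_)
open import Data.List.Membership.Propositional.Properties using (∈-∃++; ∈-++⁺ˡ; ∈-++⁺ʳ; ∈-filter⁻; ∈-tabulate⁻; ∈-map⁻; ∈-cartesianProduct⁺; ∈-cartesianProduct⁻; ∈-allFin; ∈-lookup)
open import Data.List.Relation.Unary.All as All using (All; []; _∷_)
open import Data.List.Relation.Unary.All.Properties using (¬Any⇒All¬; All¬⇒¬Any)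
open import Data.List.Relation.Unary.Any as Any using (Any; here; there)
open import Data.List.Relation.Unary.Any.Properties using (reverse⁻)
open import Data.List.Relation.Unary.AllPairs using (AllPairs; []; _∷_)
open import Data.List.Relation.Unary.Unique.Propositional using (Unique)
import Data.List.Relation.Unary.Unique.Propositional.Properties as Uniqueₚ
open import Data.Maybe using (just)
open import Data.Nat using (ℕ; zero; suc; _+_; _*_; _∸_; _≤_; _<_; z≤n; s≤s)
open import Data.Nat.ListAction using (sum)
open import Data.Nat.Properties hiding (_≟_)
open import Algebra.Properties.CommutativeSemigroup +-commutativeSemigroup using (interchange; xy∙z≈xz∙y)
open import Data.Product using (Σ; ∃; ∃₂; _×_; _,_; proj₁; proj₂)
open import Data.Sum using (_⊎_; inj₁; inj₂; [_,_]′)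
open import Data.Unit using (tt)
open import Function using (_∘_; id; mk⇔; case_of_)
open import Relation.Binary.Construct.Closure.ReflexiveTransitive as Star using (Star; ε; _◅_; _◅◅_)
open import Relation.Binary.PropositionalEquality using (_≡_; _≢_; refl; sym; trans; cong; cong₂; subst; subst₂; module ≡-Reasoning)
open import Relation.Nullary using (¬_; Dec; yes; no; does; contradiction)
open import Relation.Nullary.Decidable using (_×-dec_; _⊎-dec_; toSum; does-⇔; dec-true; dec-false)

-- By handshaking, a tree with a branch vertex has at least `excess + 2` leaves. Excess 5 thus
-- already gives seven leaves, and only excess at most 4 needs an extra vertex. A stem that is no
-- path forces a tripod, whose four branch vertices exhaust an excess of 4; so all of them have
-- degree 3, and a tree of excess at most 4 with a vertex of degree 4 is a solution.
--
-- K₁,₄-freeness enters through one star. If two of the chosen vertices charge `xy` towards `y`,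
-- then `y` is adjacent to both, to `x` and, unless it is a leaf, to a further tree neighbour `y′`;
-- each of the six possible adjacencies among these must be turned into an exchange. A leaf that
-- receives an edge adds nothing to the excess. The obstacle is `r`, which is no leaf: an edge added
-- at `r` must be paid for by a branch vertex that loses one, in the same or an earlier exchange.
-- For `r` the star is used only when the side of `y` has no branch vertex; otherwise one exchange
-- destroys every possible tripod centre.

private variable
  n : ℕ

-- Sums over vertices

bit : Bool → ℕ
bit b = if b then 1 else 0

δ : Fin n → Fin n → ℕ
δ v x = bit (does (v ≟ x))

∑ : (Fin n → ℕ) → ℕ
∑ {n} f = sum (map f (allFin n))

δ-refl : (v : Fin n) → δ v v ≡ 1
δ-refl v = cong bit (dec-true (v ≟ v) refl)

δ-≢ : {v x : Fin n} → v ≢ x → δ v x ≡ 0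
δ-≢ {v = v} {x} v≢x = cong bit (dec-false (v ≟ x) v≢x)

module _ {A : Set} where

  sum-map-mono : {f g : A → ℕ} → (∀ v → f v ≤ g v) → ∀ xs → sum (map f xs) ≤ sum (map g xs)
  sum-map-mono f≤g []       = z≤n
  sum-map-mono f≤g (x ∷ xs) = +-mono-≤ (f≤g x) (sum-map-mono f≤g xs)

  sum-map-+ : (f g : A → ℕ) → ∀ xs →
              sum (map (λ v → f v + g v) xs) ≡ sum (map f xs) + sum (map g xs)
  sum-map-+ f g []       = refl
  sum-map-+ f g (x ∷ xs) =
    trans (cong (f x + g x +_) (sum-map-+ f g xs)) (interchange (f x) (g x) _ _)

  sum-map-0 : ∀ (xs : List A) → sum (map (λ _ → 0) xs) ≡ 0
  sum-map-0 []       = refl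
  sum-map-0 (x ∷ xs) = sum-map-0 xs

  sum-map-const : ∀ c (xs : List A) → sum (map (λ _ → c) xs) ≡ length xs * c
  sum-map-const c []       = refl
  sum-map-const c (x ∷ xs) = cong (c +_) (sum-map-const c xs)

sum-map-swap : ∀ {A B : Set} (f : A → B → ℕ) xs ys →
               sum (map (λ x → sum (map (f x) ys)) xs) ≡ sum (map (λ y → sum (map (λ x → f x y) xs)) ys)
sum-map-swap f []       ys = sym (sum-map-0 ys)
sum-map-swap f (x ∷ xs) ys =
  trans (cong (sum (map (f x) ys) +_) (sum-map-swap f xs ys)) (sym (sum-map-+ (f x) _ ys))

∑-mono : {f g : Fin n → ℕ} → (∀ v → f v ≤ g v) → ∑ f ≤ ∑ g
∑-mono f≤g = sum-map-mono f≤g (allFin _)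

∑-cong : {f g : Fin n → ℕ} → (∀ v → f v ≡ g v) → ∑ f ≡ ∑ g
∑-cong f≗g = cong sum (map-cong f≗g (allFin _))

∑-+ : (f g : Fin n → ℕ) → ∑ (λ v → f v + g v) ≡ ∑ f + ∑ g
∑-+ f g = sum-map-+ f g (allFin _)

∑-const : ∀ n c → ∑ {n} (λ _ → c) ≡ n * c
∑-const n c = trans (sum-map-const c (allFin n)) (cong (_* c) (length-tabulate {n = n} id))

∑-suc : (f : Fin (suc n) → ℕ) → ∑ f ≡ f zero + ∑ (f ∘ suc)
∑-suc f = cong (f zero +_) (cong sum
  (trans (map-tabulate suc f) (sym (map-tabulate id (f ∘ suc)))))

∑-δ : (x : Fin n) → ∑ (λ v → δ v x) ≡ 1
∑-δ {suc n} zero    = trans (∑-suc {n} (λ v → δ v zero)) (cong suc (sum-map-0 (allFin n)))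
∑-δ {suc n} (suc x) = trans (∑-suc {n} (λ v → δ v (suc x))) (∑-δ x)

occ : List (Fin n) → Fin n → ℕ
occ xs v = sum (map (δ v) xs)

∑-occ : (xs : List (Fin n)) → ∑ (occ xs) ≡ length xs
∑-occ {n} []   = sum-map-0 (allFin n)
∑-occ (x ∷ xs) = trans (∑-+ (λ v → δ v x) (occ xs)) (cong₂ _+_ (∑-δ x) (∑-occ xs))

occ-∉ : {v : Fin n} (xs : List (Fin n)) → v ∉ xs → occ xs v ≡ 0
occ-∉ []       v∉ = refl
occ-∉ (x ∷ xs) v∉ = cong₂ _+_ (δ-≢ (v∉ ∘ here)) (occ-∉ xs (v∉ ∘ there))

occ-Unique : {xs : List (Fin n)} → Unique xs → ∀ v → occ xs v ≤ 1
occ-Unique [] v = z≤n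
occ-Unique {xs = x ∷ xs} (x∉ ∷ u) v with v ≟ x
... | yes refl = s≤s (≤-reflexive (occ-∉ xs (All¬⇒¬Any x∉)))
... | no _     = occ-Unique u v

_∈?_ : (v : Fin n) (xs : List (Fin n)) → Dec (v ∈ xs)
v ∈? xs = Any.any? (v ≟_) xs

occ-≤ : {xs : List (Fin n)} {f : Fin n → ℕ} → Unique xs → (∀ {v} → v ∈ xs → 1 ≤ f v) →
        ∀ v → occ xs v ≤ f v
occ-≤ {xs = xs} u h v with v ∈? xs
... | yes v∈ = ≤-trans (occ-Unique u v) (h v∈)
... | no v∉  = ≤-trans (≤-reflexive (occ-∉ xs v∉)) z≤n

length≤∑ : {xs : List (Fin n)} {f : Fin n → ℕ} → Unique xs → (∀ {v} → v ∈ xs → 1 ≤ f v) →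
           length xs ≤ ∑ f
length≤∑ {xs = xs} u h = subst (_≤ _) (∑-occ xs) (∑-mono (occ-≤ u h))

Unique⇒length≤ : {xs : List (Fin n)} → Unique xs → length xs ≤ n
Unique⇒length≤ {n} u =
  ≤-trans (length≤∑ {f = λ _ → 1} u (λ _ → ≤-refl)) (≤-reflexive (trans (∑-const n 1) (*-identityʳ n)))

-- The two outcomes need not be each other's negation, so the universal alternative can be a
-- directly usable statement.
search : ∀ {m} {A B : Fin m → Set} → (∀ i → A i ⊎ B i) → ∃ A ⊎ (∀ i → B i)
search {zero}  d = inj₂ λ ()
search {suc m} d with d zero | search (d ∘ suc)
... | inj₁ a | _            = inj₁ (zero , a)
... | inj₂ b | inj₁ (i , a) = inj₁ (suc i , a)
... | inj₂ b | inj₂ bs      = inj₂ λ { zero → b ; (suc i) → bs i }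

-- Edges and degrees

-- A record instead of the bare equation, so that the graph and the end points can be inferred from
-- the type of an edge.
record Edge (T : Graph n) (x y : Fin n) : Set where
  constructor edge
  field holds : adj T x y ≡ true
open Edge

module _ {T : Graph n} where

  edge-sym : ∀ {x y} → Edge T x y → Edge T y x
  edge-sym (edge e) = edge (trans (adj-sym T _ _) e)

  edge-irrefl : ∀ {x} → ¬ Edge T x x
  edge-irrefl (edge e) with () ← trans (sym e) (irrefl T _)

  edge⇒≢ : ∀ {x y} → Edge T x y → x ≢ y
  edge⇒≢ e refl = edge-irrefl e

  edge? : ∀ x y → Edge T x y ⊎ adj T x y ≡ false
  edge? x y with adj T x y in eq
  ... | true  = inj₁ (edge eq)
  ... | false = inj₂ refl

  length≤deg : ∀ {p xs} → Unique xs → (∀ {v} → v ∈ xs → Edge T p v) → length xs ≤ deg T p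
  length≤deg u h = length≤∑ u (λ v∈ → ≤-reflexive (sym (cong bit (holds (h v∈)))))

  -- Pigeonhole: if `xs` contained all neighbours of `p`, adjacency would be bounded pointwise by
  -- `occ xs`, whose total is `length xs`.
  neighbour∉ : ∀ {p} xs → length xs < deg T p → ∃ λ q → Edge T p q × q ∉ xs
  neighbour∉ {p} xs l = case search {B = λ q → bit (adj T p q) ≤ occ xs q} test of λ where
      (inj₁ r) → r
      (inj₂ h) → contradiction (subst (deg T p ≤_) (∑-occ xs) (∑-mono h)) (<⇒≱ l)
    where
    occ-∈ : ∀ {q ys} → q ∈ ys → 1 ≤ occ ys q
    occ-∈ {q} (here refl)          = ≤-trans (≤-reflexive (sym (δ-refl q))) (m≤m+n _ _)
    occ-∈ {q} {y ∷ _} (there q∈) = ≤-trans (occ-∈ q∈) (m≤n+m _ (δ q y))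
    test : ∀ q → (Edge T p q × q ∉ xs) ⊎ (bit (adj T p q) ≤ occ xs q)
    test q with adj T p q in eq | q ∈? xs
    ... | false | _      = inj₂ z≤n
    ... | true  | yes q∈ = inj₂ (occ-∈ q∈)
    ... | true  | no q∉  = inj₁ (edge eq , q∉)

  two-neighbours : ∀ {p a b} → Edge T p a → Edge T p b → a ≢ b → 2 ≤ deg T p
  two-neighbours ea eb a≢b = length≤deg ((a≢b ∷ []) ∷ [] ∷ [])
    λ { (here refl) → ea ; (there (here refl)) → eb }

  three-neighbours : ∀ {p a b c} → Edge T p a → Edge T p b → Edge T p c →
                     a ≢ b → a ≢ c → b ≢ c → 3 ≤ deg T p
  three-neighbours ea eb ec a≢b a≢c b≢c = length≤deg ((a≢b ∷ a≢c ∷ []) ∷ (b≢c ∷ []) ∷ [] ∷ [])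
    λ { (here refl) → ea ; (there (here refl)) → eb ; (there (there (here refl))) → ec }

-- Deleting and adding an edge

SameEdge : (a b p q : Fin n) → Set
SameEdge a b p q = (p ≡ a × q ≡ b) ⊎ (p ≡ b × q ≡ a)

sameEdge? : (a b p q : Fin n) → Dec (SameEdge a b p q)
sameEdge? a b p q = ((p ≟ a) ×-dec (q ≟ b)) ⊎-dec ((p ≟ b) ×-dec (q ≟ a))

SameEdge-sym : {a b p q : Fin n} → SameEdge a b p q → SameEdge a b q p
SameEdge-sym (inj₁ (p , q)) = inj₂ (q , p)
SameEdge-sym (inj₂ (p , q)) = inj₁ (q , p)

transport : {T : Graph n} {a b p q : Fin n} → SameEdge a b p q → Edge T a b → Edge T p q
transport (inj₁ (refl , refl)) e = e
transport (inj₂ (refl , refl)) e = edge-sym e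

transport⁻ : {T : Graph n} {a b p q : Fin n} → SameEdge a b p q → Edge T p q → Edge T a b
transport⁻ (inj₁ (refl , refl)) e = e
transport⁻ (inj₂ (refl , refl)) e = edge-sym e

does-sameEdge-sym : (a b p q : Fin n) → does (sameEdge? a b p q) ≡ does (sameEdge? a b q p)
does-sameEdge-sym a b p q = does-⇔ (mk⇔ SameEdge-sym SameEdge-sym) (sameEdge? a b p q) (sameEdge? a b q p)

delE : Graph n → (x y : Fin n) → Graph n
adj    (delE T x y) p q = adj T p q ∧ not (does (sameEdge? x y p q))
adj-sym (delE T x y) p q = cong₂ (λ b c → b ∧ not c) (adj-sym T p q) (does-sameEdge-sym x y p q)
irrefl (delE T x y) p   = cong (_∧ _) (irrefl T p)

addE : Graph n → (a b : Fin n) → a ≢ b → Graph n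
adj    (addE T a b a≢b) p q = adj T p q ∨ does (sameEdge? a b p q)
adj-sym (addE T a b a≢b) p q = cong₂ _∨_ (adj-sym T p q) (does-sameEdge-sym a b p q)
irrefl (addE T a b a≢b) p   = cong₂ _∨_ (irrefl T p)
  (dec-false (sameEdge? a b p p) λ { (inj₁ (refl , e)) → a≢b e ; (inj₂ (refl , e)) → a≢b (sym e) })

module _ {T : Graph n} {x y : Fin n} where

  delE⁺ : ∀ {p q} → Edge T p q → ¬ SameEdge x y p q → Edge (delE T x y) p q
  delE⁺ {p} {q} (edge e) ¬s =
    edge (cong₂ (λ b c → b ∧ not c) e (dec-false (sameEdge? x y p q) ¬s))

  delE⁻ : ∀ {p q} → Edge (delE T x y) p q → Edge T p q × ¬ SameEdge x y p q
  delE⁻ {p} {q} (edge e) = let e′ , ¬s = split (sameEdge? x y p q) e in edge e′ , ¬s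
    where
    split : ∀ {S : Set} (d : Dec S) {b} → b ∧ not (does d) ≡ true → b ≡ true × ¬ S
    split (no ¬s) {true}  _ = refl , ¬s
    split (yes _) {true}  ()
    split _       {false} ()

module _ {T : Graph n} {a b : Fin n} {a≢b : a ≢ b} where

  addE-old : ∀ {p q} → Edge T p q → Edge (addE T a b a≢b) p q
  addE-old (edge e) = edge (cong (_∨ _) e)

  addE-new : Edge (addE T a b a≢b) a b
  addE-new = edge (trans (cong (adj T a b ∨_) (dec-true (sameEdge? a b a b) (inj₁ (refl , refl)))) (∨-zeroʳ _))

  addE⁻ : ∀ {p q} → Edge (addE T a b a≢b) p q → Edge T p q ⊎ SameEdge a b p q
  addE⁻ {p} {q} (edge e) = split (sameEdge? a b p q) e
    where
    split : ∀ (d : Dec (SameEdge a b p q)) → adj T p q ∨ does d ≡ true → Edge T p q ⊎ SameEdge a b p q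
    split (yes s) _ = inj₂ s
    split (no _)  e = inj₁ (edge (trans (sym (∨-identityʳ _)) e))

∑-sameEdge : {a b : Fin n} → a ≢ b → ∀ p → ∑ (λ q → bit (does (sameEdge? a b p q))) ≡ δ p a + δ p b
∑-sameEdge {n} {a} {b} a≢b p with p ≟ a | p ≟ b
... | yes refl | yes refl = contradiction refl a≢b
... | yes refl | no _ = trans (∑-cong {n} λ q → cong bit (does-≟ q)) (∑-δ b)
  where
  does-≟ : ∀ q → does (((q ≟ b)) ) ∨ false ≡ does (q ≟ b)
  does-≟ q = ∨-identityʳ _
... | no _ | yes refl = ∑-δ a
... | no _ | no _ = sum-map-0 (allFin n)

module _ {T : Graph n} where

  deg-delE : ∀ {x y} → Edge T x y → ∀ p → deg (delE T x y) p + (δ p x + δ p y) ≡ deg T p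
  deg-delE {x} {y} e p = trans (cong (deg (delE T x y) p +_) (sym (∑-sameEdge (edge⇒≢ e) p)))
    (trans (sym (∑-+ {n} _ _)) (∑-cong {n} pointwise))
    where
    split : ∀ {S : Set} (d : Dec S) {b} → (S → b ≡ true) → bit (b ∧ not (does d)) + bit (does d) ≡ bit b
    split (yes s) h rewrite h s = refl
    split (no _)  h = trans (+-identityʳ _) (cong bit (∧-identityʳ _))
    pointwise : ∀ q → bit (adj (delE T x y) p q) + bit (does (sameEdge? x y p q)) ≡ bit (adj T p q)
    pointwise q = split (sameEdge? x y p q) λ s → holds (transport s e)

  deg-addE : ∀ {a b} (a≢b : a ≢ b) → ¬ Edge T a b → ∀ p →
             deg (addE T a b a≢b) p ≡ deg T p + (δ p a + δ p b)
  deg-addE {a} {b} a≢b ¬e p = trans (∑-cong {n} pointwise)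
    (trans (∑-+ {n} _ _) (cong (deg T p +_) (∑-sameEdge a≢b p)))
    where
    nonadj : ∀ {u v} → ¬ Edge T u v → adj T u v ≡ false
    nonadj {u} {v} ¬e = [ (λ e → contradiction e ¬e) , id ]′ (edge? u v)
    split : ∀ {S : Set} (d : Dec S) {b} → (S → b ≡ false) → bit (b ∨ does d) ≡ bit b + bit (does d)
    split (yes s) h rewrite h s = refl
    split (no _)  h = trans (cong bit (∨-identityʳ _)) (sym (+-identityʳ _))
    pointwise : ∀ q → bit (adj (addE T a b a≢b) p q) ≡ bit (adj T p q) + bit (does (sameEdge? a b p q))
    pointwise q = split (sameEdge? a b p q) λ s → nonadj (λ e → ¬e (transport⁻ s e))

-- Walks, forests and trees

module _ {V : Set} {R : V → V → Set} where

  avoiding : ∀ {x y z} → (∀ {a} → Star R a x → a ≢ y) → Star R z x →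
             Star (λ a b → R a b × a ≢ y × b ≢ y) z x
  avoiding h ε       = ε
  avoiding h (e ◅ w) = (e , h (e ◅ w) , h w) ◅ avoiding h w

enter : ∀ {R : Fin n → Fin n → Set} {z x} → z ≢ x → Star R z x →
        ∃ λ p → R p x × Star (λ a b → R a b × a ≢ x × b ≢ x) z p
enter z≢x ε = contradiction refl z≢x
enter {x = x} z≢x (_◅_ {j = z′} e w) with z′ ≟ x
... | yes refl = _ , e , ε
... | no z′≢x  = let p , e′ , w′ = enter z′≢x w in p , e′ , (e , z≢x , z′≢x) ◅ w′

-- A walk with several passages along `ab` can be shortcut between them, so one passage, in either
-- direction, is the worst case.
viaNew : ∀ {R R′ : Fin n → Fin n → Set} {a b} → (∀ {p q} → R′ p q → R p q ⊎ SameEdge a b p q) →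
         ∀ {p q} → Star R′ p q →
         Star R p q ⊎ (Star R p a × Star R b q) ⊎ (Star R p b × Star R a q)
viaNew f ε = inj₁ ε
viaNew f (e ◅ w) with f e | viaNew f w
... | inj₁ r | inj₁ w′              = inj₁ (r ◅ w′)
... | inj₁ r | inj₂ (inj₁ (s , t)) = inj₂ (inj₁ (r ◅ s , t))
... | inj₁ r | inj₂ (inj₂ (s , t)) = inj₂ (inj₂ (r ◅ s , t))
... | inj₂ (inj₁ (refl , refl)) | inj₁ w′              = inj₂ (inj₁ (ε , w′))
... | inj₂ (inj₁ (refl , refl)) | inj₂ (inj₁ (s , t)) = inj₂ (inj₁ (ε , t))
... | inj₂ (inj₁ (refl , refl)) | inj₂ (inj₂ (s , t)) = inj₁ t
... | inj₂ (inj₂ (refl , refl)) | inj₁ w′              = inj₂ (inj₂ (ε , w′))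
... | inj₂ (inj₂ (refl , refl)) | inj₂ (inj₁ (s , t)) = inj₁ t
... | inj₂ (inj₂ (refl , refl)) | inj₂ (inj₂ (s , t)) = inj₂ (inj₂ (ε , t))

Off : Graph n → Fin n → Fin n → Fin n → Set
Off T r x y = Edge T x y × x ≢ r × y ≢ r

-- For an edge xy of a tree: z lies in the component of x when xy is deleted.
On : Graph n → (x y z : Fin n) → Set
On T x y z = Star (Off T y) z x

-- Acyclicity in the form that every edge is a bridge. Exchanges ask what stays connected after a
-- deletion, and this form answers directly; `acyclic` converts it into the absence of cycles.
Forest : Graph n → Set
Forest T = ∀ {x y} → Edge T x y → ¬ Star (Edge (delE T x y)) x y

record Tree (T : Graph n) : Set where
  field
    connected : ∀ u v → Star (Edge T) u v
    forest    : Forest T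

module _ {T : Graph n} where

  walk-sym : ∀ {u v} → Star (Edge T) u v → Star (Edge T) v u
  walk-sym = Star.reverse edge-sym

  undelete : ∀ {x y u v} → Star (Edge (delE T x y)) u v → Star (Edge T) u v
  undelete = Star.map (proj₁ ∘ delE⁻)

  off-sym : ∀ {r u v} → Star (Off T r) u v → Star (Off T r) v u
  off-sym = Star.reverse λ (e , p , q) → edge-sym e , q , p

  off⇒del : ∀ {x y u v} → Star (Off T y) u v → Star (Edge (delE T x y)) u v
  off⇒del = Star.map λ (e , p≢ , q≢) →
    delE⁺ e λ { (inj₁ (_ , q≡)) → q≢ q≡ ; (inj₂ (p≡ , _)) → p≢ p≡ }

  off⇒delˡ : ∀ {x y u v} → Star (Off T x) u v → Star (Edge (delE T x y)) u v
  off⇒delˡ = Star.map λ (e , p≢ , q≢) →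
    delE⁺ e λ { (inj₁ (p≡ , _)) → p≢ p≡ ; (inj₂ (_ , q≡)) → q≢ q≡ }

  del-sym : ∀ {x y u v} → Star (Edge (delE T x y)) u v → Star (Edge (delE T y x)) u v
  del-sym = Star.map λ e → let e′ , ¬s = delE⁻ e in delE⁺ e′ λ
    { (inj₁ (p , q)) → ¬s (inj₂ (p , q)) ; (inj₂ (p , q)) → ¬s (inj₁ (p , q)) }

  on-≢ : ∀ {x y z} → Edge T x y → On T x y z → z ≢ y
  on-≢ e ε                = edge⇒≢ e
  on-≢ e ((_ , p , _) ◅ _) = p

  on-step : ∀ {x y z z′} → Edge T x y → On T x y z → Edge T z z′ → z′ ≢ y → On T x y z′
  on-step exy o e z′≢y = (edge-sym e , z′≢y , on-≢ exy o) ◅ o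

  inside : ∀ {x y z} → On T x y z → Star (λ a b → Edge T a b × On T x y a × On T x y b) z x
  inside ε       = ε
  inside (o ◅ w) = (proj₁ o , o ◅ w , w) ◅ inside w

module Forestₚ {T : Graph n} (forest : Forest T) where

  on-excl : ∀ {x y z} → Edge T x y → On T x y z → On T y x z → ⊥
  on-excl e p q = forest e (off⇒del (off-sym p) ◅◅ off⇒delˡ q)

  -- Otherwise the edge `py` and a walk through `z` away from `y` would bypass the bridge `xy`.
  -- Hence each vertex other than `y` determines one direction at `y`.
  on-unique : ∀ {x y p z} → Edge T x y → Edge T p y → On T x y z → On T p y z → x ≡ p
  on-unique {x} {y} {p} e e′ o o′ with x ≟ p
  ... | yes x≡p = x≡p
  ... | no x≢p  = contradiction
      (off⇒del (off-sym o ◅◅ o′) ◅◅ delE⁺ e′ (λ { (inj₁ (p≡x , _)) → x≢p (sym p≡x)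
                                                 ; (inj₂ (p≡y , _)) → edge⇒≢ e′ p≡y }) ◅ ε)
      (forest e)

  on-cross : ∀ {x y a b} → Edge T x y → Edge T a b → On T x y a → On T y x b → a ≡ x × b ≡ y
  on-cross {x} {y} {a} {b} e e′ oa ob with a ≟ x | b ≟ y
  ... | yes a≡x | yes b≡y = a≡x , b≡y
  ... | _       | no b≢y  = ⊥-elim (on-excl e (on-step e oa e′ b≢y) ob)
  ... | no a≢x  | _       = ⊥-elim (on-excl e oa (on-step (edge-sym e) ob (edge-sym e′) a≢x))

  on-avoid : ∀ {x y z s} → Edge T x y → On T x y z → On T y x s → Star (Off T s) z x
  on-avoid e oz os = Star.map (λ (ab , oa , ob) → ab , avoid oa , avoid ob) (inside oz)
    where
    avoid : ∀ {a} → On T _ _ a → a ≢ _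
    avoid oa refl = on-excl e oa os

forest-delE : {T : Graph n} {x y : Fin n} → Forest T → Forest (delE T x y)
forest-delE f e w = f (proj₁ (delE⁻ e)) (Star.map (λ e → let e′ , ¬s = delE⁻ e in delE⁺ (proj₁ (delE⁻ e′)) ¬s) w)

-- A walk bypassing the new edge would join `a` to `b` in `T`. A walk bypassing an old edge either
-- lies in `T` or uses `ab` once, and then its two parts together with the old edge join `a` to `b`
-- in `T`.
forest-addE : {T : Graph n} {a b : Fin n} (a≢b : a ≢ b) → Forest T → ¬ Star (Edge T) a b →
              Forest (addE T a b a≢b)
forest-addE {T = T} {a} {b} a≢b f ¬w {x} {y} e w with addE⁻ {T = T} {a≢b = a≢b} e
... | inj₂ s = ¬w (flip s (Star.map old w))
  where
  same : ∀ {p q} → SameEdge a b x y → SameEdge a b p q → SameEdge x y p q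
  same (inj₁ (refl , refl)) s′ = s′
  same (inj₂ (refl , refl)) (inj₁ s′) = inj₂ s′
  same (inj₂ (refl , refl)) (inj₂ s′) = inj₁ s′
  old : ∀ {p q} → Edge (delE (addE T a b a≢b) x y) p q → Edge T p q
  old e = let e′ , ¬s = delE⁻ e in [ id , (λ s′ → contradiction (same s s′) ¬s) ]′ (addE⁻ {T = T} {a≢b = a≢b} e′)
  flip : SameEdge a b x y → Star (Edge T) x y → Star (Edge T) a b
  flip (inj₁ (refl , refl)) w = w
  flip (inj₂ (refl , refl)) w = walk-sym w
... | inj₁ e₀ with viaNew {R = Edge (delE T x y)} split w
  where
  split : ∀ {p q} → Edge (delE (addE T a b a≢b) x y) p q → Edge (delE T x y) p q ⊎ SameEdge a b p q
  split e = let e′ , ¬s = delE⁻ e in [ (λ e → inj₁ (delE⁺ e ¬s)) , inj₂ ]′ (addE⁻ {T = T} {a≢b = a≢b} e′)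
... | inj₁ w′              = f e₀ w′
... | inj₂ (inj₁ (s , t)) = ¬w (walk-sym (undelete s) ◅◅ e₀ ◅ walk-sym (undelete t))
... | inj₂ (inj₂ (s , t)) = ¬w (undelete t ◅◅ edge-sym e₀ ◅ undelete s)

module Treeₚ {T : Graph n} (tree : Tree T) where
  open Tree tree public
  open Forestₚ forest public

  -- The walk from `z` to `x` is cut where it first uses the edge; the end reached there tells the
  -- side.
  side : ∀ {x y} → Edge T x y → ∀ z → On T x y z ⊎ On T y x z
  side {x} {y} e z = [ inj₁ ∘ avoid (λ w → forest (edge-sym e) (del-sym w)) , inj₂ ∘ avoid (forest e) ]′ (cut (connected z x))
    where
    cut : ∀ {z} → Star (Edge T) z x → Star (Edge (delE T x y)) z x ⊎ Star (Edge (delE T x y)) z y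
    cut ε = inj₁ ε
    cut (_◅_ {z} {z′} e w) with sameEdge? x y z z′
    ... | yes (inj₁ (refl , _)) = inj₁ ε
    ... | yes (inj₂ (refl , _)) = inj₂ ε
    ... | no ¬s = [ (λ w → inj₁ (delE⁺ e ¬s ◅ w)) , (λ w → inj₂ (delE⁺ e ¬s ◅ w)) ]′ (cut w)
    avoid : ∀ {p q} → ¬ Star (Edge (delE T x y)) q p → Star (Edge (delE T x y)) z p → On T p q z
    avoid ¬w w = Star.map (λ (e , h) → proj₁ (delE⁻ e) , h)
                          (avoiding (λ { w refl → ¬w w }) w)

  toward : ∀ {z x} → z ≢ x → ∃ λ p → Edge T p x × On T p x z
  toward z≢x = enter z≢x (connected _ _)

  nest : ∀ {x y w z} → Edge T x y → Edge T w x → w ≢ y → On T w x z → On T x y z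
  nest e e′ w≢y o with side e _
  ... | inj₁ o′ = o′
  ... | inj₂ o′ = contradiction (on-unique e′ (edge-sym e) o o′) w≢y

  on-leaf : ∀ {x y z} → Edge T x y → deg T x ≤ 1 → On T x y z → z ≡ x
  on-leaf {x} {y} {z} e l o with z ≟ x
  ... | yes z≡x = z≡x
  ... | no z≢x  = let w , (e′ , w≢y , _) , _ = enter z≢x o in
    contradiction (≤-trans (two-neighbours e (edge-sym e′) (w≢y ∘ sym)) l) λ { (s≤s ()) }

  on-thin : ∀ {q p p′ z} → Edge T q p → Edge T p p′ → q ≢ p′ → deg T p ≤ 2 → On T p p′ z →
            z ≡ p ⊎ On T q p z
  on-thin {q} {p} {p′} {z} e e′ q≢p′ d o with z ≟ p
  ... | yes z≡p = inj₁ z≡p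
  ... | no z≢p with enter z≢p o
  ... | w , (ew , w≢p′ , _) , walk with w ≟ q
  ... | yes refl = inj₂ (Star.map (λ ((e , _) , h) → e , h) walk)
  ... | no w≢q   = contradiction (three-neighbours (edge-sym e) e′ (edge-sym ew) q≢p′ (w≢q ∘ sym) (w≢p′ ∘ sym)) (≤⇒≯ d)

-- Climbing towards a target

-- A walk from p to t that never returns to a vertex it has left.
data Dir (T : Graph n) (t : Fin n) : Fin n → Set where
  here : Dir T t t
  step : ∀ {p p′} → Edge T p p′ → On T p′ p t → Dir T t p′ → Dir T t p

module _ {T : Graph n} where

  revisit : ∀ {t q} → Dir T t q → ∀ p → Dir T t p ⊎ (q ≢ p × Star (Off T p) t q)
  revisit {t} here p with p ≟ t
  ... | yes refl = inj₁ here
  ... | no p≢t   = inj₂ (p≢t ∘ sym , ε)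
  revisit (step {q} {q′} e o d) p with p ≟ q | revisit d p
  ... | yes refl | _                 = inj₁ (step e o d)
  ... | no _     | inj₁ d′           = inj₁ d′
  ... | no p≢q   | inj₂ (q′≢p , w) = inj₂ (p≢q ∘ sym , w ◅◅ (edge-sym e , q′≢p , p≢q ∘ sym) ◅ ε)

  -- Loop erasure: if `p` turns up again, `revisit` restarts from that later passage; otherwise the
  -- remaining walk avoids `p` and is the witness for `On`.
  direct : ∀ {t p} → Star (Edge T) p t → Dir T t p
  direct ε = here
  direct (e ◅ w) with revisit (direct w) _
  ... | inj₁ d        = d
  ... | inj₂ (_ , w′) = step e w′ (direct w)

Bare : Graph n → (x y : Fin n) → Set
Bare T x y = ∀ z → On T x y z → deg T z ≤ 2

-- The edge `q p` is pushed towards `t` while its front end differs from `t` and has degree at most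
-- 2, so the part behind it stays bare. `swallow` and `leaves*` serve the climb in `clash-bare`,
-- which starts at an inner edge: they place `p` behind the final edge, and keep leaves that were
-- ahead of the first edge ahead of the final one.
record Climb (T : Graph n) (q p t : Fin n) : Set where
  field
    {q* p*} : Fin n
    edge*   : Edge T q* p*
    bare*   : Bare T q* p*
    target* : On T p* q* t
    stop    : p* ≡ t ⊎ 3 ≤ deg T p*
    grow    : ∀ {z} → On T q p z → On T q* p* z
    swallow : deg T p ≤ 2 → p ≢ t → On T q* p* p
    leaves* : ∀ {z} → deg T z ≤ 1 → On T p q z → On T p* q* z

module Climbing {T : Graph n} (tree : Tree T) where
  open Treeₚ tree

  climb : ∀ {q p t} → Dir T t p → Edge T q p → On T p q t → Bare T q p → Climb T q p t
  climb here e o bare = record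
    { edge* = e ; bare* = bare ; target* = o ; stop = inj₁ refl
    ; grow = id ; swallow = λ _ p≢t → contradiction refl p≢t ; leaves* = λ _ → id }
  climb {q} {p} {t} (step {p′ = p′} e′ o′ d) e o bare with 3 ≤? deg T p
  ... | yes b = record
    { edge* = e ; bare* = bare ; target* = o ; stop = inj₂ b
    ; grow = id ; swallow = λ ¬b _ → contradiction b (≤⇒≯ ¬b) ; leaves* = λ _ → id }
  ... | no ¬b = record
    { edge* = edge* ; bare* = bare* ; target* = target* ; stop = stop
    ; grow = grow ∘ nest e′ e q≢p′
    ; swallow = λ _ _ → grow ε
    ; leaves* = λ l oz → leaves* l (pass l oz) }
    where
    thin : deg T p ≤ 2
    thin = ≤-pred (≰⇒> ¬b)
    q≢p′ : q ≢ p′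
    q≢p′ refl = on-excl e′ o o′
    pass : ∀ {z} → deg T z ≤ 1 → On T p q z → On T p′ p z
    pass {z} l oz with side e′ z
    ... | inj₂ oz′ = oz′
    ... | inj₁ oz′ with on-thin e e′ q≢p′ thin oz′
    ... | inj₁ refl = contradiction (≤-trans (two-neighbours (edge-sym e) e′ q≢p′) l) λ { (s≤s ()) }
    ... | inj₂ oq   = ⊥-elim (on-excl e oq oz)
    bare′ : Bare T p p′
    bare′ z oz = [ (λ { refl → thin }) , bare z ]′ (on-thin e e′ q≢p′ thin oz)
    open Climb (climb d e′ o′ bare′)

  -- In the second case b is the first branch vertex on the way from u to t, and c the vertex after it.
  clear : ∀ {u t} → deg T u ≤ 1 → u ≢ t →
          (∃ λ x → Edge T x t × On T x t u × Bare T x t) ⊎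
          (∃₂ λ b c → Edge T b c × 3 ≤ deg T b × b ≢ t × On T b c u × On T c b t)
  clear {u} {t} l u≢t with direct (connected u t)
  ... | here = contradiction refl u≢t
  ... | step e o d = go (climb d e o bare)
    where
    bare : Bare T u _
    bare z oz with refl ← on-leaf e l oz = m≤n⇒m≤1+n l
    go : Climb T u _ t → _
    go c = go′ stop
      where
      open Climb c
      go′ : p* ≡ t ⊎ 3 ≤ deg T p* → _
      go′ (inj₁ refl) = inj₁ (q* , edge* , grow ε , bare*)
      go′ (inj₂ b) with p* ≟ t
      ... | yes refl = inj₁ (q* , edge* , grow ε , bare*)
      ... | no p*≢t with toward (p*≢t ∘ sym)
      ... | c , ec , oc with side ec u
      ... | inj₂ ou = inj₂ (p* , c , edge-sym ec , b , p*≢t , ou , oc)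
      ... | inj₁ ou with on-unique ec edge* ou (grow ε)
      ... | refl = ⊥-elim (on-excl edge* oc target*)

-- Exchanging a tree edge

module Swap {T : Graph n} (tree : Tree T) {x y a b : Fin n}
            (e : Edge T x y) (oa : On T x y a) (ob : On T y x b) where
  open Treeₚ tree

  a≢b : a ≢ b
  a≢b refl = on-excl e oa ob

  separated : ¬ Star (Edge (delE T x y)) a b
  separated w = forest e (off⇒del (off-sym oa) ◅◅ w ◅◅ off⇒delˡ ob)

  swap : Graph n
  swap = addE (delE T x y) a b a≢b

  swap-keep : ∀ {p q} → Edge T p q → ¬ SameEdge x y p q → Edge swap p q
  swap-keep e ¬s = addE-old {a≢b = a≢b} (delE⁺ e ¬s)

  swap-new : Edge swap a b
  swap-new = addE-new {T = delE T x y} {a≢b = a≢b}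

  swap⁻ : ∀ {p q} → Edge swap p q → (Edge T p q × ¬ SameEdge x y p q) ⊎ SameEdge a b p q
  swap⁻ e = [ inj₁ ∘ delE⁻ , inj₂ ]′ (addE⁻ {T = delE T x y} {a≢b = a≢b} e)

  swap-tree : Tree swap
  swap-tree = record
    { connected = λ u v → (replace Star.⋆) (connected u v)
    ; forest    = forest-addE a≢b (forest-delE forest) separated }
    where
    old : ∀ {u v} → Star (Edge (delE T x y)) u v → Star (Edge swap) u v
    old = Star.map (addE-old {a≢b = a≢b})
    x⇝y : Star (Edge swap) x y
    x⇝y = old (off⇒del (off-sym oa)) ◅◅ swap-new ◅ old (off⇒delˡ ob)
    replace : ∀ {p q} → Edge T p q → Star (Edge swap) p q
    replace {p} {q} e with sameEdge? x y p q
    ... | yes (inj₁ (refl , refl)) = x⇝y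
    ... | yes (inj₂ (refl , refl)) = walk-sym x⇝y
    ... | no ¬s                    = swap-keep e ¬s ◅ ε

  -- Written additively because the end points of the two edges may coincide: each coincidence is
  -- settled by cancelling `δ` terms, without truncated subtraction.
  swap-deg : ∀ v → deg swap v + (δ v x + δ v y) ≡ deg T v + (δ v a + δ v b)
  swap-deg v = begin
    deg swap v + (δ v x + δ v y)                              ≡⟨ cong (_+ _) (deg-addE a≢b (λ e → separated (e ◅ ε)) v) ⟩
    deg (delE T x y) v + (δ v a + δ v b) + (δ v x + δ v y)    ≡⟨ xy∙z≈xz∙y (deg (delE T x y) v) _ _ ⟩
    deg (delE T x y) v + (δ v x + δ v y) + (δ v a + δ v b)    ≡⟨ cong (_+ _) (deg-delE e v) ⟩
    deg T v + (δ v a + δ v b)                                 ∎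
    where open ≡-Reasoning

-- Existence of spanning trees

record Spanning (G T : Graph n) : Set where
  field
    tree : Tree T
    sub  : ∀ {x y} → Edge T x y → Edge G x y

-- `f` names the component of each vertex, which makes it decidable whether a further edge would
-- close a cycle.
record Labelled (G T : Graph n) (f : Fin n → Fin n) : Set where
  field
    forest : Forest T
    sub    : ∀ {x y} → Edge T x y → Edge G x y
    label⁻ : ∀ {x y} → f x ≡ f y → Star (Edge T) x y
    label⁺ : ∀ {x y} → Edge T x y → f x ≡ f y

module _ {G T : Graph n} {f : Fin n → Fin n} (L : Labelled G T f)
         {u v : Fin n} (e : Edge G u v) (fu≢fv : f u ≢ f v) where
  open Labelled L

  relabel : Fin n → Fin n
  relabel w with f w ≟ f u
  ... | yes _ = f v
  ... | no _  = f w

  relabel-≡ : ∀ {x y} → f x ≡ f y → relabel x ≡ relabel y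
  relabel-≡ {x} {y} fx≡fy with f x ≟ f u | f y ≟ f u
  ... | yes _ | yes _ = refl
  ... | no _  | no _  = fx≡fy
  ... | yes p | no q  = contradiction (trans (sym fx≡fy) p) q
  ... | no p  | yes q = contradiction (trans fx≡fy q) p

  label-walk : ∀ {x y} → Star (Edge T) x y → f x ≡ f y
  label-walk ε       = refl
  label-walk (e ◅ w) = trans (label⁺ e) (label-walk w)

  merge : Labelled G (addE T u v (edge⇒≢ e)) relabel
  merge = record
    { forest = forest-addE (edge⇒≢ e) forest (fu≢fv ∘ label-walk)
    ; sub    = λ e′ → [ sub , (λ s → transport s e) ]′ (addE⁻ {T = T} {a≢b = edge⇒≢ e} e′)
    ; label⁻ = joined
    ; label⁺ = λ e′ → [ relabel-≡ ∘ label⁺ , new ]′ (addE⁻ {T = T} {a≢b = edge⇒≢ e} e′) }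
    where
    old : ∀ {x y} → f x ≡ f y → Star (Edge (addE T u v (edge⇒≢ e))) x y
    old eq = Star.map (addE-old {a≢b = edge⇒≢ e}) (label⁻ eq)
    u⇝v : Star (Edge (addE T u v (edge⇒≢ e))) u v
    u⇝v = addE-new {T = T} {a≢b = edge⇒≢ e} ◅ ε
    joined : ∀ {x y} → relabel x ≡ relabel y → Star (Edge (addE T u v (edge⇒≢ e))) x y
    joined {x} {y} eq with f x ≟ f u | f y ≟ f u
    ... | yes p | yes q = old (trans p (sym q))
    ... | no _  | no _  = old eq
    ... | yes p | no _  = old p ◅◅ u⇝v ◅◅ old eq
    ... | no _  | yes q = old eq ◅◅ walk-sym u⇝v ◅◅ old (sym q)
    u~v : relabel u ≡ relabel v
    u~v with f u ≟ f u | f v ≟ f u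
    ... | yes _ | yes _ = refl
    ... | yes _ | no _  = refl
    ... | no ¬p | _     = contradiction refl ¬p
    new : ∀ {x y} → SameEdge u v x y → relabel x ≡ relabel y
    new (inj₁ (refl , refl)) = u~v
    new (inj₂ (refl , refl)) = sym u~v

edgeless : Graph n
adj     edgeless _ _ = false
adj-sym edgeless _ _ = refl
irrefl  edgeless _   = refl

kruskal : (G : Graph n) (ps : List (Fin n × Fin n)) →
          ∃₂ λ T f → Labelled G T f × (∀ {u v} → (u , v) ∈ ps → Edge G u v → f u ≡ f v)
kruskal G [] = edgeless , id , record
  { forest = λ () ; sub = λ () ; label⁻ = λ { refl → ε } ; label⁺ = λ () } , λ ()
kruskal G ((u , v) ∷ ps) with kruskal G ps
... | T , f , L , h with edge? {T = G} u v | f u ≟ f v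
... | inj₂ ¬e | _     = T , f , L , λ { (here refl) (edge e) → contradiction (trans (sym e) ¬e) λ ()
                                      ; (there p) e → h p e }
... | inj₁ e  | yes q = T , f , L , λ { (here refl) _ → q ; (there p) e → h p e }
... | inj₁ e  | no q  = _ , relabel L e q , merge L e q , λ
  { (here refl) _ → Labelled.label⁺ (merge L e q) (addE-new {T = T} {a≢b = edge⇒≢ e})
  ; (there p) e′ → relabel-≡ L e q (h p e′) }

spanning-tree : {G : Graph n} → (∀ u v → Star (Edge G) u v) → ∃ λ T → Spanning G T
spanning-tree {n} {G} conn with kruskal G (cartesianProduct (allFin n) (allFin n))
... | T , f , L , h = T , record
  { tree = record { connected = λ u v → label⁻ (constant (conn u v)) ; forest = forest }
  ; sub  = sub }
  where
  open Labelled L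
  constant : ∀ {u v} → Star (Edge G) u v → f u ≡ f v
  constant ε       = refl
  constant (e ◅ w) = trans (h (∈-cartesianProduct⁺ (∈-allFin _) (∈-allFin _)) e) (constant w)

-- Walks as vertex lists

last⇒∈ : ∀ {A : Set} {xs : List A} {x} → last xs ≡ just x → x ∈ xs
last⇒∈ {xs = x ∷ []}     refl = here refl
last⇒∈ {xs = x ∷ y ∷ xs} eq   = there (last⇒∈ eq)

last-++ : ∀ {A : Set} (xs : List A) {y ys} → last (xs ++ y ∷ ys) ≡ last (y ∷ ys)
last-++ []            = refl
last-++ (x ∷ [])      = refl
last-++ (x ∷ x′ ∷ xs) = last-++ (x′ ∷ xs)

Unique-++ʳ : ∀ {A : Set} (xs : List A) {ys} → Unique (xs ++ ys) → Unique ys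
Unique-++ʳ []       u       = u
Unique-++ʳ (x ∷ xs) (_ ∷ u) = Unique-++ʳ xs u

Unique-++-≢ : ∀ {A : Set} (xs : List A) {ys v w} → Unique (xs ++ ys) → v ∈ xs → w ∈ ys → v ≢ w
Unique-++-≢ (x ∷ xs) (x∉ ∷ _) (here refl) w∈ = All.lookup x∉ (∈-++⁺ʳ xs w∈)
Unique-++-≢ (x ∷ xs) (_ ∷ u)  (there v∈)  w∈ = Unique-++-≢ xs u v∈ w∈

lookup-injective : ∀ {A : Set} {xs : List A} → Unique xs → ∀ {i j} → lookup xs i ≡ lookup xs j → i ≡ j
lookup-injective (_ ∷ _)  {zero}  {zero}  _  = refl
lookup-injective (x∉ ∷ _) {zero}  {suc j} eq = contradiction eq (All.lookup x∉ (∈-lookup j))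
lookup-injective (x∉ ∷ _) {suc i} {zero}  eq = contradiction (sym eq) (All.lookup x∉ (∈-lookup i))
lookup-injective (_ ∷ u)  {suc i} {suc j} eq = cong suc (lookup-injective u eq)

Unique-reverse : ∀ {A : Set} {xs : List A} → Unique xs → Unique (reverse xs)
Unique-reverse [] = []
Unique-reverse {xs = x ∷ xs} (x∉ ∷ u) rewrite unfold-reverse x xs =
  Uniqueₚ.++⁺ (Unique-reverse u) ([] ∷ []) λ { (v∈ , here refl) → All¬⇒¬Any x∉ (reverse⁻ v∈) }

module _ {T : Graph n} where

  Consec-tail : ∀ {x xs} → Consec T (x ∷ xs) → Consec T xs
  Consec-tail {xs = []}    _       = tt
  Consec-tail {xs = _ ∷ _} (_ , c) = c

  Consec-++ʳ : ∀ xs {ys} → Consec T (xs ++ ys) → Consec T ys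
  Consec-++ʳ []       c = c
  Consec-++ʳ (x ∷ xs) c = Consec-++ʳ xs (Consec-tail c)

  Consec-∷ : ∀ {x y xs} → Edge T x y → head xs ≡ just y → Consec T xs → Consec T (x ∷ xs)
  Consec-∷ {xs = y ∷ xs} e refl c = holds e , c

  Consec-join : ∀ xs {y ys} → Consec T (xs ++ [ y ]) → Consec T (y ∷ ys) → Consec T (xs ++ y ∷ ys)
  Consec-join []            _       d = d
  Consec-join (x ∷ [])      (e , _) d = e , d
  Consec-join (x ∷ x′ ∷ xs) (e , c) d = e , Consec-join (x′ ∷ xs) c d

  Consec-reverse : ∀ xs → Consec T xs → Consec T (reverse xs)
  Consec-reverse []           _ = tt
  Consec-reverse (x ∷ [])     _ = tt
  Consec-reverse (x ∷ y ∷ xs) (e , c) = subst (Consec T) (sym reverse≡)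
    (Consec-join (reverse xs) (subst (Consec T) (unfold-reverse y xs) (Consec-reverse (y ∷ xs) c))
                 (holds (edge-sym (edge {T = T} e)) , tt))
    where
    reverse≡ : reverse (x ∷ y ∷ xs) ≡ reverse xs ++ y ∷ [ x ]
    reverse≡ = trans (unfold-reverse x (y ∷ xs))
      (trans (cong (_++ [ x ]) (unfold-reverse y xs)) (++-assoc (reverse xs) [ y ] [ x ]))

  run : ∀ {v x xs y} → Consec T (x ∷ xs) → v ∉ x ∷ xs → y ∈ x ∷ xs → Star (Off T v) x y
  run c v∉ (here refl) = ε
  run {xs = x′ ∷ xs} (e , c) v∉ (there y∈) =
    (edge e , v∉ ∘ here ∘ sym , v∉ ∘ there ∘ here ∘ sym) ◅ run c (v∉ ∘ there) y∈

  up-to : ∀ {x} xs {y ys} → Consec T ((x ∷ xs) ++ y ∷ ys) → y ∉ x ∷ xs →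
          ∃ λ q → q ∈ x ∷ xs × Edge T q y × Star (Off T y) x q
  up-to []        (e , _) _  = _ , here refl , edge e , ε
  up-to (x′ ∷ xs) (e , c) y∉ with up-to xs c (y∉ ∘ there)
  ... | q , q∈ , e′ , w = q , there q∈ , e′ , (edge e , y∉ ∘ here ∘ sym , y∉ ∘ there ∘ here ∘ sym) ◅ w

  between : ∀ {a b v} qs → Consec T qs → Unique qs → head qs ≡ just a → last qs ≡ just b →
            v ∈ qs → v ≢ a → v ≢ b →
            ∃₂ λ p q → Edge T p v × Edge T q v × p ≢ q × Star (Off T v) a p × Star (Off T v) q b
  between (x ∷ qs) _ _ refl _ (here v≡x) v≢a _ = contradiction v≡x v≢a
  between {v = v} (x ∷ y ∷ qs) (e , c) (x∉ ∷ u) refl eq (there v∈) v≢a v≢b with y ≟ v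
  ... | no y≢v = let p , q , ep , eq , p≢q , s , t = between (y ∷ qs) c u refl eq v∈ (y≢v ∘ sym) v≢b
                 in p , q , ep , eq , p≢q , (edge e , v≢a ∘ sym , y≢v) ◅ s , t
  between (x ∷ y ∷ []) _ _ refl refl _ _ v≢b | yes refl = contradiction refl v≢b
  between (x ∷ y ∷ d ∷ qs) (e , e′ , c) ((_ ∷ x≢d ∷ _) ∷ (y∉ ∷ _)) refl eq _ _ _ | yes refl =
    x , d , edge e , edge-sym (edge e′) , x≢d , ε , run c (All¬⇒¬Any y∉) (last⇒∈ eq)

  walk⇒star : ∀ ws {u v} → IsWalk T u v ws → Star (Edge T) u v
  walk⇒star (w ∷ [])      (_ , refl , refl)     = ε
  walk⇒star (w ∷ w′ ∷ ws) ((e , c) , refl , eq) = edge e ◅ walk⇒star (w′ ∷ ws) (c , refl , eq)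

  star⇒walk : ∀ {u v} → Star (Edge T) u v → ∃ (IsWalk T u v)
  star⇒walk ε = [ _ ] , tt , refl , refl
  star⇒walk (e ◅ w) with star⇒walk w
  ... | ws@(_ ∷ _) , c , refl , eq = _ ∷ ws , (holds e , c) , refl , eq

-- Stems and tripods

module _ {T : Graph n} (tree : Tree T) where
  open Treeₚ tree

  acyclic : Acyclic T
  acyclic (a ∷ [])     (s≤s () , _)
  acyclic (a ∷ c ∷ []) (s≤s (s≤s ()) , _)
  acyclic (a ∷ c ∷ d ∷ cs) (_ , (a∉ ∷ (c∉ ∷ _)) , (e , e′) , .a , b , refl , eq , eb) =
    contradiction (on-unique (edge-sym (edge e)) (edge eb) ε (run e′ (All¬⇒¬Any a∉) (there b∈)))
                  (All.lookup c∉ b∈)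
    where
    b∈ : b ∈ d ∷ cs
    b∈ = last⇒∈ eq

  isTree : IsTree T
  isTree = (λ u v → star⇒walk (connected u v)) , acyclic

  stem-empty : (∀ v → ¬ IsBranch T v) → StemIsPath T
  stem-empty h = [] , [] , tt , λ v → (λ ()) , λ (a , _ , _ , b , _) → contradiction b (h a)

  stem-of-spine : ∀ {a z} P → IsPath T a z P → IsBranch T a → IsBranch T z →
                  (∀ v → IsBranch T v → v ∈ P) → StemIsPath T
  stem-of-spine {a} {z} (p ∷ P) path@((c , _) , u) ba bz all =
    p ∷ P , u , c , λ v → (λ v∈ → a , z , p ∷ P , ba , bz , path , v∈) , stem⊆ v
    where
    stem⊆ : ∀ v → InStem T v → v ∈ p ∷ P
    stem⊆ v (a′ , b′ , qs , ba′ , bb′ , ((c′ , h , l) , u′) , v∈) with v ∈? (p ∷ P)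
    ... | yes v∈P = v∈P
    -- The two neighbours of `v` on the path `qs` are joined away from `v`, by way of the two branch
    -- vertices and `P`; but different neighbours of `v` lie in different directions.
    ... | no v∉P with between qs c′ u′ h l v∈ (λ { refl → v∉P (all _ ba′) }) (λ { refl → v∉P (all _ bb′) })
    ... | p₁ , p₂ , e₁ , e₂ , p₁≢p₂ , s , t = contradiction
      (on-unique e₁ e₂ ε (off-sym s ◅◅ off-sym (run c v∉P (all _ ba′)) ◅◅ run c v∉P (all _ bb′) ◅◅ off-sym t))
      p₁≢p₂

  -- The obstruction to a path as stem. A tip need not be the first branch vertex on its arm.
  record Tripod : Set where
    field
      {centre}  : Fin n
      arm tip   : Fin 3 → Fin n
      arm-edge  : ∀ i → Edge T (arm i) centre
      arm-inj   : ∀ {i j} → arm i ≡ arm j → i ≡ j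
      tip-deg   : ∀ i → IsBranch T (tip i)
      tip-on    : ∀ i → On T (arm i) centre (tip i)

  record Attached (P : List (Fin n)) (z : Fin n) : Set where
    field
      {foot}  : Fin n
      limb    : List (Fin n)
      foot∈   : foot ∈ P
      unique  : Unique limb
      off     : ∀ {v} → v ∈ limb → v ∉ P
      consec  : Consec T (limb ++ [ foot ])
      headed  : head (limb ++ [ foot ]) ≡ just z

  -- The walk is cut at its first vertex in `P`, and loops are erased: if `z` recurs in the limb,
  -- everything before the recurrence is discarded.
  attach : ∀ {P z t} → Star (Edge T) z t → t ∈ P → Attached P z
  attach ε t∈ = record { limb = [] ; foot∈ = t∈ ; unique = [] ; off = λ () ; consec = tt ; headed = refl }
  attach {P} {z} (e ◅ w) t∈ with attach w t∈ | z ∈? P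
  ... | _ | yes z∈ = record { limb = [] ; foot∈ = z∈ ; unique = [] ; off = λ () ; consec = tt ; headed = refl }
  ... | A | no z∉ with z ∈? Attached.limb A
  ... | no z∉limb = record
    { limb = z ∷ limb ; foot∈ = foot∈ ; unique = ¬Any⇒All¬ _ z∉limb ∷ unique
    ; off = λ { (here refl) → z∉ ; (there v∈) → off v∈ }
    ; consec = Consec-∷ e headed consec ; headed = refl }
    where open Attached A
  ... | yes z∈limb with Attached.limb A | Attached.unique A | Attached.off A | Attached.consec A | ∈-∃++ z∈limb
  ... | _ | u | off | c | xs , ys , refl = record
    { limb = z ∷ ys ; foot∈ = Attached.foot∈ A ; unique = Unique-++ʳ xs u
    ; off = off ∘ ∈-++⁺ʳ xs
    ; consec = Consec-++ʳ xs (subst (Consec T) (++-assoc xs (z ∷ ys) _) c) ; headed = refl }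

  extend : ∀ {b j z′ Q P} → Unique (b ∷ Q) → Consec T (b ∷ Q ++ [ j ]) → (∀ {v} → v ∈ b ∷ Q → v ∉ j ∷ P) →
           IsPath T j z′ (j ∷ P) → IsPath T b z′ (b ∷ Q ++ j ∷ P)
  extend {b} {Q = Q} u c off ((c′ , _ , l) , u′) =
    (Consec-join (b ∷ Q) c c′ , refl , trans (last-++ (b ∷ Q)) l) ,
    Uniqueₚ.++⁺ u u′ λ (v∈ , v∈′) → off v∈ v∈′

  longer : ∀ m q {k} → n ≤ suc m + k → n ≤ m + (suc q + k)
  longer m q {k} le = ≤-trans le (≤-trans (≤-reflexive (sym (+-suc m k))) (+-monoʳ-≤ m (s≤s (m≤n+m k q))))

  -- A path between branch vertices is prolonged as long as a branch vertex off it attaches to an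
  -- end; an attachment at an inner vertex gives a tripod.
  spine : ∀ m {a z} P → IsPath T a z P → IsBranch T a → IsBranch T z → n ≤ m + length P →
          StemIsPath T ⊎ Tripod
  prolong : ∀ m {a z b} P → IsPath T a z P → IsBranch T a → IsBranch T z → n ≤ m + length P →
            IsBranch T b → b ∉ P → Attached P b → StemIsPath T ⊎ Tripod

  spine m {a} {z} P path@((_ , h , _) , _) ba bz n≤ with search test
    where
    test : ∀ v → (IsBranch T v × v ∉ P) ⊎ (IsBranch T v → v ∈ P)
    test v with 3 ≤? deg T v | v ∈? P
    ... | _     | yes v∈ = inj₂ λ _ → v∈
    ... | yes b | no v∉  = inj₁ (b , v∉)
    ... | no ¬b | no _   = inj₂ λ b → contradiction b ¬b
  ... | inj₂ all            = inj₁ (stem-of-spine P path ba bz all)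
  ... | inj₁ (b , bb , b∉) = prolong m P path ba bz n≤ bb b∉ (attach (connected b a) (head⇒∈ h))
    where
    head⇒∈ : ∀ {xs : List (Fin n)} {x} → head xs ≡ just x → x ∈ xs
    head⇒∈ {_ ∷ _} refl = here refl

  -- `m` bounds the number of vertices off `P`; at zero there is no room for `b`.
  prolong zero P (_ , u) _ _ n≤ _ b∉ _ = contradiction (Unique⇒length≤ (¬Any⇒All¬ P b∉ ∷ u)) (<⇒≱ (s≤s n≤))
  prolong (suc m) P _ _ _ _ _ b∉ record { limb = [] ; foot∈ = foot∈ ; headed = refl } = contradiction foot∈ b∉
  prolong (suc m) {z = z} P path@((c , h , l) , u) ba bz n≤ bb b∉
    record { foot = j ; limb = b ∷ Q ; foot∈ = foot∈ ; unique = uQ ; off = off ; consec = cQ ; headed = refl }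
    with ∈-∃++ foot∈
  ... | [] , P₂ , refl with refl ← h =
    spine m (b ∷ Q ++ P) (extend uQ cQ off path) bb bz
      (subst (λ k → n ≤ m + suc k) (sym (length-++ Q)) (longer m (length Q) n≤))
  -- The foot is the last vertex: reversing `P` brings it to the front.
  ... | x ∷ P₁ , [] , refl with refl ← h =
    spine m (b ∷ Q ++ R) (extend uQ cQ (λ v∈ v∈R → off v∈ (reverse⁻ (subst (_ ∈_) (sym R≡) v∈R)))
            ((subst (Consec T) R≡ (Consec-reverse P c) , refl , lastR) , subst Unique R≡ (Unique-reverse u)))
      bb ba (subst (λ k → n ≤ m + suc k) (sym (trans (length-++ Q) (cong (length Q +_)
              (trans (cong length (sym R≡)) (length-reverse P))))) (longer m (length Q) n≤))
    where
    R : List (Fin n)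
    R = j ∷ reverse (x ∷ P₁)
    R≡ : reverse P ≡ R
    R≡ = reverse-++ (x ∷ P₁) [ j ]
    lastR : last R ≡ just x
    lastR = trans (cong (last ∘ (j ∷_)) (unfold-reverse x P₁)) (last-++ (j ∷ reverse P₁))
  ... | x ∷ P₁ , y ∷ P₂ , refl with refl ← h
      | up-to P₁ c (λ j∈ → Unique-++-≢ (x ∷ P₁) u j∈ (here refl) refl)
      | up-to Q cQ (λ j∈ → off j∈ foot∈)
      | Unique-++ʳ (x ∷ P₁) u | Consec-++ʳ (x ∷ P₁) c
  -- The arms at the foot `j` are its two neighbours on `P` and the last vertex of the limb; the
  -- tips are the two ends of `P` and `b`.
  ... | q₁ , q₁∈ , e₁ , w₁ | q₃ , q₃∈ , e₃ , w₃ | j∉ ∷ _ | e₂ , c₂ = inj₂ record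
    { arm = lookup (q₁ ∷ y ∷ q₃ ∷ []) ; tip = lookup (x ∷ z ∷ b ∷ [])
    ; arm-edge = λ { zero → e₁ ; (suc zero) → edge-sym (edge e₂) ; (suc (suc zero)) → e₃ }
    ; arm-inj  = lookup-injective
        ((Unique-++-≢ (x ∷ P₁) u q₁∈ (there (here refl)) ∷ (λ { refl → off q₃∈ (∈-++⁺ˡ q₁∈) }) ∷ []) ∷
         ((λ { refl → off q₃∈ (∈-++⁺ʳ (x ∷ P₁) (there (here refl))) }) ∷ []) ∷ [] ∷ [])
    ; tip-deg  = λ { zero → ba ; (suc zero) → bz ; (suc (suc zero)) → bb }
    ; tip-on   = λ { zero → w₁
                   ; (suc zero) → off-sym (run c₂ (All¬⇒¬Any j∉) (last⇒∈ (trans (sym (last-++ (x ∷ P₁))) l)))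
                   ; (suc (suc zero)) → w₃ } }

  stem-or-tripod : StemIsPath T ⊎ Tripod
  stem-or-tripod with search {B = λ v → ¬ IsBranch T v} (λ v → [ inj₁ , inj₂ ]′ (toSum (3 ≤? deg T v)))
  ... | inj₂ none    = inj₁ (stem-empty none)
  ... | inj₁ (b , h) = spine n [ b ] ((tt , refl , refl) , [] ∷ []) h h (m≤m+n n 1)

-- Counting leaves and degrees

excess : Graph n → ℕ
excess T = ∑ (λ v → deg T v ∸ 2)

leaves : Graph n → List (Fin n)
leaves {n} T = filter (λ v → deg T v ≤? 1) (allFin n)

length-filter : ∀ {A : Set} {P : A → Set} (P? : ∀ x → Dec (P x)) xs →
                length (filter P? xs) ≡ sum (map (λ x → bit (does (P? x))) xs)
length-filter P? []       = refl
length-filter P? (x ∷ xs) with does (P? x)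
... | true  = cong suc (length-filter P? xs)
... | false = length-filter P? xs

2+[m∸2] : ∀ m → 2 + (m ∸ 2) ≡ m + (2 ∸ m)
2+[m∸2] 0             = refl
2+[m∸2] 1             = refl
2+[m∸2] (suc (suc m)) = sym (trans (cong (2 + m +_) (0∸n≡0 m)) (+-identityʳ _))

module Rooted {T : Graph n} (tree : Tree T) (ρ : Fin n) where
  open Treeₚ tree

  upward : Fin n → Fin n → ℕ
  upward w x with ρ ≟ w
  ... | yes _  = 0
  ... | no ρ≢w = δ x (proj₁ (toward ρ≢w))

  ∑-upward : ∀ w → ∑ (upward w) + δ w ρ ≡ 1
  ∑-upward w with ρ ≟ w
  ... | yes refl = cong₂ _+_ (sum-map-0 (allFin n)) (δ-refl ρ)
  ... | no ρ≢w   = cong₂ _+_ (∑-δ (proj₁ (toward ρ≢w))) (δ-≢ (ρ≢w ∘ sym))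

  upward-edge : ∀ {w x} → Edge T x w → On T x w ρ → 1 ≤ upward w x
  upward-edge {w} {x} e o with ρ ≟ w
  ... | yes refl = contradiction refl (on-≢ e o)
  ... | no ρ≢w with toward ρ≢w
  ... | p , e′ , o′ with refl ← on-unique e e′ o o′ = ≤-reflexive (sym (δ-refl x))

  adj≤upward : ∀ w x → bit (adj T w x) ≤ upward w x + upward x w
  adj≤upward w x with adj T w x in eq
  ... | false = z≤n
  ... | true with side (edge eq) ρ
  ... | inj₁ o = ≤-trans (upward-edge (edge eq) o) (m≤n+m _ (upward w x))
  ... | inj₂ o = ≤-trans (upward-edge (edge-sym (edge eq)) o) (m≤m+n _ _)

  -- Of the two ends of an edge, one is the next vertex on the way from the other to `ρ`, so
  -- `upward` accounts for every edge; each of the `n - 1` vertices other than `ρ` has exactly one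
  -- such next vertex.
  ∑-deg≤ : ∑ (deg T) + 2 ≤ n * 2
  ∑-deg≤ = begin
    ∑ (deg T) + 2                                                  ≤⟨ +-monoˡ-≤ 2 (∑-mono {n} λ w →
                                                                        ≤-trans (∑-mono {n} (adj≤upward w)) (≤-reflexive (∑-+ {n} _ _))) ⟩
    ∑ (λ w → ∑ (upward w) + ∑ (λ x → upward x w)) + 2              ≡⟨ cong (_+ 2) (∑-+ {n} _ _) ⟩
    S + ∑ (λ w → ∑ (λ x → upward x w)) + 2                         ≡⟨ cong (λ k → S + k + 2) (sum-map-swap upward (allFin n) (allFin n)) ⟨
    S + S + 2                                                      ≡⟨ interchange S S 1 1 ⟩
    (S + 1) + (S + 1)                                              ≡⟨ cong₂ _+_ S+1≡n S+1≡n ⟩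
    n + n                                                          ≡⟨ cong (n +_) (+-identityʳ n) ⟨
    2 * n                                                          ≡⟨ *-comm 2 n ⟩
    n * 2                                                          ∎
    where
    open ≤-Reasoning
    S : ℕ
    S = ∑ (λ w → ∑ (upward w))
    S+1≡n : S + 1 ≡ n
    S+1≡n = trans (cong (S +_) (sym (∑-δ ρ)))
      (trans (sym (∑-+ {n} _ _)) (trans (∑-cong {n} ∑-upward) (trans (∑-const n 1) (*-identityʳ n))))

  -- Handshaking, with `2 + (d ∸ 2)` rewritten as `d + (2 ∸ d)` for each degree `d`. The branch
  -- vertex `ρ` excludes the one-vertex tree, whose deficit of 2 comes from a single vertex.
  excess+2≤leaves : 3 ≤ deg T ρ → excess T + 2 ≤ length (leaves T)
  excess+2≤leaves b = ≤-trans (+-cancelˡ-≤ (n * 2) _ _ (begin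
    n * 2 + (excess T + 2)                         ≡⟨ +-assoc (n * 2) _ 2 ⟨
    n * 2 + excess T + 2                           ≡⟨ cong (λ k → k + excess T + 2) (∑-const n 2) ⟨
    ∑ {n} (λ _ → 2) + excess T + 2                 ≡⟨ cong (_+ 2) (trans (sym (∑-+ {n} _ _)) (trans (∑-cong {n} (2+[m∸2] ∘ deg T)) (∑-+ {n} _ _))) ⟩
    ∑ (deg T) + ∑ (λ v → 2 ∸ deg T v) + 2          ≡⟨ xy∙z≈xz∙y (∑ (deg T)) _ 2 ⟩
    ∑ (deg T) + 2 + ∑ (λ v → 2 ∸ deg T v)          ≤⟨ +-monoˡ-≤ _ ∑-deg≤ ⟩
    n * 2 + ∑ (λ v → 2 ∸ deg T v)                  ∎))
    (≤-trans (∑-mono {n} λ v → deficit (deg T v) (1≤deg v)) (≤-reflexive (sym (length-filter _ (allFin n)))))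
    where
    open ≤-Reasoning
    deficit : ∀ d → 1 ≤ d → 2 ∸ d ≤ bit (does (d ≤? 1))
    deficit 1             _ = ≤-refl
    deficit (suc (suc d)) _ = ≤-trans (≤-reflexive (0∸n≡0 d)) z≤n
    1≤deg : ∀ v → 1 ≤ deg T v
    1≤deg v with ρ ≟ v
    ... | yes refl = ≤-trans (s≤s z≤n) b
    ... | no ρ≢v   = length≤deg {T = T} {xs = [ _ ]} ([] ∷ []) λ { (here refl) → edge-sym (proj₁ (proj₂ (toward ρ≢v))) }

  -- The lower end, with ρ as the top, of the first tree edge on the way from w to u.
  key : Fin n × Fin n → Fin n
  key (u , w) with u ≟ w
  ... | yes _  = ρ
  ... | no u≢w with toward u≢w
  ... | x , e , _ with side e ρ
  ... | inj₁ _ = w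
  ... | inj₂ _ = x

  record Keyed (u w z : Fin n) : Set where
    field
      {from} : Fin n
      edge*  : Edge T from w
      on     : On T from w u
      lower  : (z ≡ w × On T from w ρ) ⊎ (z ≡ from × On T w from ρ)

  keyed : ∀ {u w} → u ≢ w → Keyed u w (key (u , w))
  keyed {u} {w} u≢w with u ≟ w
  ... | yes u≡w = contradiction u≡w u≢w
  ... | no u≢w′ with toward u≢w′
  ... | x , e , o with side e ρ
  ... | inj₁ oρ = record { edge* = e ; on = o ; lower = inj₁ (refl , oρ) }
  ... | inj₂ oρ = record { edge* = e ; on = o ; lower = inj₂ (refl , oρ) }

  keyed-≢ : ∀ {u w z} → Keyed u w z → ρ ≢ z
  keyed-≢ record { edge* = e ; lower = inj₁ (refl , o) } = on-≢ e o
  keyed-≢ record { edge* = e ; lower = inj₂ (refl , o) } = on-≢ (edge-sym e) o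

  -- A vertex other than `ρ` is the lower end of one edge only, so a common key means a common edge,
  -- passed in the same or in opposite directions.
  same-dart : ∀ {u w u′ w′ z} (K : Keyed u w z) (K′ : Keyed u′ w′ z) →
              (Keyed.from K ≡ Keyed.from K′ × w ≡ w′) ⊎ (Keyed.from K ≡ w′ × w ≡ Keyed.from K′)
  same-dart record { edge* = e ; lower = inj₁ (refl , o) } record { edge* = e′ ; lower = inj₁ (refl , o′) } =
    inj₁ (on-unique e e′ o o′ , refl)
  same-dart record { edge* = e ; lower = inj₁ (refl , o) } record { edge* = e′ ; lower = inj₂ (refl , o′) } =
    inj₂ (on-unique e (edge-sym e′) o o′ , refl)
  same-dart record { edge* = e ; lower = inj₂ (refl , o) } record { edge* = e′ ; lower = inj₁ (refl , o′) } =
    inj₂ (refl , on-unique (edge-sym e) e′ o o′)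
  same-dart record { edge* = e ; lower = inj₂ (refl , o) } record { edge* = e′ ; lower = inj₂ (refl , o′) } =
    inj₁ (refl , on-unique (edge-sym e) (edge-sym e′) o o′)

-- Charging and degree sums

uniqueOr : ∀ {A C : Set} (f : A → Fin n) ps → Unique ps →
           (∀ {p q} → p ∈ ps → q ∈ ps → p ≢ q → f p ≡ f q → C) → C ⊎ Unique (map f ps)
uniqueOr f []       _ _ = inj₂ []
uniqueOr f (p ∷ ps) (p∉ ∷ u) h with f p ∈? map f ps | uniqueOr f ps u (λ p∈ q∈ → h (there p∈) (there q∈))
... | _     | inj₁ c  = inj₁ c
... | no ∉  | inj₂ u′ = inj₂ (¬Any⇒All¬ _ ∉ ∷ u′)
... | yes ∈ | inj₂ _  = let q , q∈ , eq = ∈-map⁻ f ∈ in inj₁ (h (here refl) (there q∈) (All.lookup p∉ q∈) eq)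

module _ {G T : Graph n} (S : Spanning G T) where
  open Spanning S

  private
    adj? : (p : Fin n × Fin n) → Dec (adj G (proj₁ p) (proj₂ p) ≡ true)
    adj? (u , w) = adj G u w ≟ᵇ true

    adjacentPairs : List (Fin n) → List (Fin n × Fin n)
    adjacentPairs us = filter adj? (cartesianProduct us (allFin n))

  -- A pair (u , w) of G-adjacent vertices is charged to the last tree edge xw on the way from u to w.
  -- The degree sum is therefore less than n unless some tree edge is charged by two vertices.
  degree-sum : ∀ {C : Set} (ρ : Fin n) us → Unique us →
    (∀ {u u′ x y} → u ∈ us → u′ ∈ us → u ≢ u′ → Edge T x y → On T x y u → Edge G u y →
       (On T x y u′ × Edge G u′ y) ⊎ (On T y x u′ × Edge G u′ x) → C) →
    C ⊎ sum (map (deg G) us) < n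
  degree-sum {C} ρ us u clash with uniqueOr key (adjacentPairs us) (Uniqueₚ.filter⁺ adj? (Uniqueₚ.cartesianProduct⁺ u (Uniqueₚ.allFin⁺ n))) collision
    where
    open Rooted tree ρ
    open Treeₚ tree
    pair : ∀ {u w} → (u , w) ∈ adjacentPairs us → u ∈ us × Edge G u w
    pair p∈ = let p∈′ , e = ∈-filter⁻ adj? {xs = cartesianProduct us (allFin n)} p∈
              in proj₁ (∈-cartesianProduct⁻ us (allFin n) p∈′) , edge e
    collision : ∀ {p q} → p ∈ adjacentPairs us → q ∈ adjacentPairs us → p ≢ q → key p ≡ key q → C
    collision {u , w} {u′ , w′} p∈ q∈ p≢q eq with pair p∈ | pair q∈
    ... | u∈ , e | u′∈ , e′
      with keyed (edge⇒≢ e) | subst (Keyed u′ w′) (sym eq) (keyed (edge⇒≢ e′))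
    -- For a single vertex `u`, the same direction means the same pair, and opposite directions
    -- would put `u` on both sides of the edge.
    ... | K | K′ with same-dart K K′ | u ≟ u′
    ... | inj₁ (_ , refl)    | yes refl = contradiction refl p≢q
    ... | inj₂ (refl , refl) | yes refl = ⊥-elim (on-excl (Keyed.edge* K) (Keyed.on K) (Keyed.on K′))
    ... | inj₁ (refl , refl) | no u≢u′  = clash u∈ u′∈ u≢u′ (Keyed.edge* K) (Keyed.on K) e (inj₁ (Keyed.on K′ , e′))
    ... | inj₂ (refl , refl) | no u≢u′  = clash u∈ u′∈ u≢u′ (Keyed.edge* K) (Keyed.on K) e (inj₂ (Keyed.on K′ , e′))
  ... | inj₁ c  = inj₁ c
  -- `ρ` is never a lower end; adjoining it to the distinct keys makes the bound strict.
  ... | inj₂ u′ = inj₂ (subst (λ k → suc k ≤ n) (trans (length-map key (adjacentPairs us)) (length-pairs us))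
                             (Unique⇒length≤ (¬Any⇒All¬ _ ρ∉ ∷ u′)))
    where
    open Rooted tree ρ
    ρ∉ : ρ ∉ map key (adjacentPairs us)
    ρ∉ ρ∈ with ∈-map⁻ key ρ∈
    ... | (u , w) , p∈ , eq with ∈-filter⁻ adj? {xs = cartesianProduct us (allFin n)} p∈
    ... | _ , e = keyed-≢ (keyed (edge⇒≢ (edge {T = G} e))) eq
    bit-adj : ∀ b → bit (does (b ≟ᵇ true)) ≡ bit b
    bit-adj true  = refl
    bit-adj false = refl
    length-pairs : ∀ us → length (adjacentPairs us) ≡ sum (map (deg G) us)
    length-pairs []       = refl
    length-pairs (u ∷ us) = begin
      length (filter adj? (row ++ rest))                     ≡⟨ cong length (filter-++ adj? row rest) ⟩
      length (filter adj? row ++ filter adj? rest)           ≡⟨ length-++ (filter adj? row) ⟩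
      length (filter adj? row) + length (filter adj? rest)   ≡⟨ cong₂ _+_ rowdeg (length-pairs us) ⟩
      deg G u + sum (map (deg G) us)                         ∎
      where
      open ≡-Reasoning
      row rest : List (Fin n × Fin n)
      row  = map (u ,_) (allFin n)
      rest = cartesianProduct us (allFin n)
      rowdeg : length (filter adj? row) ≡ deg G u
      rowdeg = trans (length-filter adj? row) (cong sum (trans (sym (map-∘ (allFin n))) (map-cong (bit-adj ∘ adj G u) (allFin n))))

-- Degrees and excess under an exchange

module Swapₚ {T : Graph n} (tree : Tree T) {x y a b : Fin n}
             (e : Edge T x y) (oa : On T x y a) (ob : On T y x b) where
  open Swap tree e oa ob public

  private
    x≢y : x ≢ y
    x≢y = edge⇒≢ e

  deg-≤ : ∀ {v} → v ≢ a → v ≢ b → deg swap v ≤ deg T v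
  deg-≤ {v} v≢a v≢b = ≤-trans (m≤m+n _ _) (≤-reflexive (trans (swap-deg v)
    (trans (cong₂ (λ k l → deg T v + (k + l)) (δ-≢ v≢a) (δ-≢ v≢b)) (+-identityʳ _))))

  deg-≥ : ∀ {v} → v ≢ x → v ≢ y → deg T v ≤ deg swap v
  deg-≥ {v} v≢x v≢y = ≤-trans (m≤m+n _ _) (≤-reflexive (trans (sym (swap-deg v))
    (trans (cong₂ (λ k l → deg swap v + (k + l)) (δ-≢ v≢x) (δ-≢ v≢y)) (+-identityʳ _))))

  deg-≤suc : ∀ {v} → deg swap v ≤ suc (deg T v)
  deg-≤suc {v} = case v ≟ a of λ where
      (no v≢a)   → ≤-trans (m≤m+n _ _) (≤-trans (≤-reflexive (trans (swap-deg v)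
        (cong (λ k → deg T v + (k + δ v b)) (δ-≢ v≢a)))) (≤-trans (+-monoʳ-≤ (deg T v) (δ≤1 b)) (≤-reflexive (+-comm _ 1))))
      (yes refl) → ≤-trans (m≤m+n _ _) (≤-reflexive (trans (swap-deg a)
        (trans (cong₂ (λ k l → deg T a + (k + l)) (δ-refl a) (δ-≢ a≢b)) (+-comm _ 1))))
    where
    δ≤1 : ∀ w → δ v w ≤ 1
    δ≤1 w with does (v ≟ w)
    ... | true  = ≤-refl
    ... | false = z≤n

  deg-x : x ≢ a → x ≢ b → suc (deg swap x) ≡ deg T x
  deg-x x≢a x≢b = trans (+-comm 1 _) (trans (sym (cong₂ (λ k l → deg swap x + (k + l)) (δ-refl x) (δ-≢ x≢y)))
    (trans (swap-deg x) (trans (cong₂ (λ k l → deg T x + (k + l)) (δ-≢ x≢a) (δ-≢ x≢b)) (+-identityʳ _))))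

  deg-a : a ≢ x → a ≢ y → deg swap a ≡ suc (deg T a)
  deg-a a≢x a≢y = trans (sym (+-identityʳ _)) (trans (sym (cong₂ (λ k l → deg swap a + (k + l)) (δ-≢ a≢x) (δ-≢ a≢y)))
    (trans (swap-deg a) (trans (cong₂ (λ k l → deg T a + (k + l)) (δ-refl a) (δ-≢ a≢b)) (+-comm _ 1))))

  deg-b : b ≢ x → b ≢ y → deg swap b ≡ suc (deg T b)
  deg-b b≢x b≢y = trans (sym (+-identityʳ _)) (trans (sym (cong₂ (λ k l → deg swap b + (k + l)) (δ-≢ b≢x) (δ-≢ b≢y)))
    (trans (swap-deg b) (trans (cong₂ (λ k l → deg T b + (k + l)) (δ-≢ (a≢b ∘ sym)) (δ-refl b)) (+-comm _ 1))))

  -- The edge is merely turned about `y`, which loses one edge and regains one.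
  deg-shared : b ≡ y → ∀ {v} → deg swap v + δ v x ≡ deg T v + δ v a
  deg-shared refl {v} = +-cancelʳ-≡ (δ v y) _ _
    (trans (+-assoc (deg swap v) _ _) (trans (swap-deg v) (sym (+-assoc (deg T v) _ _))))

  deg-shared-≤ : b ≡ y → ∀ {v} → v ≢ a → deg swap v ≤ deg T v
  deg-shared-≤ b≡y {v} v≢a = ≤-trans (m≤m+n _ _)
    (≤-reflexive (trans (deg-shared b≡y) (trans (cong (deg T v +_) (δ-≢ v≢a)) (+-identityʳ _))))

  deg-shared-≥ : b ≡ y → ∀ {v} → v ≢ x → deg T v ≤ deg swap v
  deg-shared-≥ b≡y {v} v≢x = ≤-trans (m≤m+n _ _)
    (≤-reflexive (trans (sym (deg-shared b≡y)) (trans (cong (deg swap v +_) (δ-≢ v≢x)) (+-identityʳ _))))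

  leaf-excess : ∀ {v} → deg T v ≤ 1 → deg swap v ∸ 2 ≡ 0
  leaf-excess l = m≤n⇒m∸n≡0 (≤-trans deg-≤suc (s≤s l))

  -- The branch vertex `x` gives up one unit, and `g` bounds what the others gain: it is zero when
  -- only leaves gain degree, and `δ` at the one other vertex that may.
  excess-drop : (g : Fin n → ℕ) → 3 ≤ deg T x → x ≢ a → x ≢ b →
                (∀ {v} → v ≢ x → deg swap v ∸ 2 ≤ deg T v ∸ 2 + g v) → excess swap + 1 ≤ excess T + ∑ g
  excess-drop g b x≢a x≢b h = begin
    excess swap + 1                        ≡⟨ cong (excess swap +_) (∑-δ x) ⟨
    excess swap + ∑ (λ v → δ v x)          ≡⟨ ∑-+ {n} _ _ ⟨
    ∑ (λ v → deg swap v ∸ 2 + δ v x)       ≤⟨ ∑-mono {n} pointwise ⟩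
    ∑ (λ v → deg T v ∸ 2 + g v)            ≡⟨ ∑-+ {n} _ _ ⟩
    excess T + ∑ g                         ∎
    where
    open ≤-Reasoning
    drop : ∀ {d d′} → 3 ≤ d → suc d′ ≡ d → d′ ∸ 2 + 1 ≤ d ∸ 2
    drop (s≤s (s≤s (s≤s {n = k} _))) refl = ≤-reflexive (+-comm k 1)
    pointwise : ∀ v → deg swap v ∸ 2 + δ v x ≤ deg T v ∸ 2 + g v
    pointwise v = case v ≟ x of λ where
      (yes refl) → ≤-trans (≤-reflexive (cong (deg swap x ∸ 2 +_) (δ-refl x))) (≤-trans (drop b (deg-x x≢a x≢b)) (m≤m+n _ _))
      (no v≢x)   → ≤-trans (≤-reflexive (trans (cong (deg swap v ∸ 2 +_) (δ-≢ v≢x)) (+-identityʳ _))) (h v≢x)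

  excess-leaf-≤ : deg T a ≤ 1 → b ≡ y → excess swap ≤ excess T
  excess-leaf-≤ l b≡y = ∑-mono {n} pointwise
    where
    pointwise : ∀ v → deg swap v ∸ 2 ≤ deg T v ∸ 2
    pointwise v = case v ≟ a of λ where
      (yes refl) → ≤-trans (≤-reflexive (leaf-excess l)) z≤n
      (no v≢a)   → ∸-monoˡ-≤ 2 (deg-shared-≤ b≡y v≢a)

  branch≢leaf : ∀ {v} → 3 ≤ deg T x → deg T v ≤ 1 → x ≢ v
  branch≢leaf b l refl = contradiction (≤-trans b l) λ { (s≤s ()) }

  private
    drop-0 : excess swap + 1 ≤ excess T + ∑ {n} (λ _ → 0) → excess swap < excess T
    drop-0 le = subst₂ _≤_ (+-comm _ 1) (trans (cong (excess T +_) (sum-map-0 (allFin n))) (+-identityʳ _)) le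

    drop-δ : ∀ w → excess swap + 1 ≤ excess T + ∑ {n} (λ v → δ v w) → excess swap ≤ excess T
    drop-δ w le = +-cancelʳ-≤ 1 _ _ (subst (λ k → excess swap + 1 ≤ excess T + k) (∑-δ w) le)

  excess-leaf-< : deg T a ≤ 1 → b ≡ y → 3 ≤ deg T x → excess swap < excess T
  excess-leaf-< l b≡y br = drop-0 (excess-drop (λ _ → 0) br (branch≢leaf br l) (λ { refl → x≢y b≡y }) λ {v} _ → bound v)
    where
    bound : ∀ v → deg swap v ∸ 2 ≤ deg T v ∸ 2 + 0
    bound v = case v ≟ a of λ where
      (yes refl) → ≤-trans (≤-reflexive (leaf-excess l)) z≤n
      (no v≢a)   → ≤-trans (∸-monoˡ-≤ 2 (deg-shared-≤ b≡y v≢a)) (m≤m+n _ 0)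

  excess-leaves-< : deg T a ≤ 1 → deg T b ≤ 1 → 3 ≤ deg T x → excess swap < excess T
  excess-leaves-< la lb br = drop-0 (excess-drop (λ _ → 0) br (branch≢leaf br la) (branch≢leaf br lb) λ {v} _ → bound v)
    where
    bound : ∀ v → deg swap v ∸ 2 ≤ deg T v ∸ 2 + 0
    bound v = case (v ≟ a) , (v ≟ b) of λ where
      (yes refl , _)      → ≤-trans (≤-reflexive (leaf-excess la)) z≤n
      (_ , yes refl)      → ≤-trans (≤-reflexive (leaf-excess lb)) z≤n
      (no v≢a , no v≢b)   → ≤-trans (∸-monoˡ-≤ 2 (deg-≤ v≢a v≢b)) (m≤m+n _ 0)

  excess-suc : ∀ {v} → deg swap v ∸ 2 ≤ deg T v ∸ 2 + δ v v
  excess-suc {v} = subst (λ k → deg swap v ∸ 2 ≤ deg T v ∸ 2 + k) (sym (δ-refl v))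
    (≤-trans (∸-monoˡ-≤ 2 deg-≤suc) (m+n≤o+n (deg T v)))
    where
    m+n≤o+n : ∀ d → suc d ∸ 2 ≤ d ∸ 2 + 1
    m+n≤o+n 0             = z≤n
    m+n≤o+n 1             = z≤n
    m+n≤o+n (suc (suc d)) = ≤-reflexive (+-comm 1 d)

  excess-gain-b : deg T a ≤ 1 → 3 ≤ deg T x → x ≢ b → excess swap ≤ excess T
  excess-gain-b l br x≢b = drop-δ b (excess-drop (λ v → δ v b) br (branch≢leaf br l) x≢b λ {v} _ → bound v)
    where
    bound : ∀ v → deg swap v ∸ 2 ≤ deg T v ∸ 2 + δ v b
    bound v = case v ≟ b of λ where
      (yes refl) → excess-suc
      (no v≢b)   → case v ≟ a of λ where
        (yes refl) → ≤-trans (≤-reflexive (leaf-excess l)) z≤n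
        (no v≢a)   → ≤-trans (∸-monoˡ-≤ 2 (deg-≤ v≢a v≢b)) (m≤m+n _ _)

  excess-gain-a : b ≡ y → 3 ≤ deg T x → x ≢ a → excess swap ≤ excess T
  excess-gain-a b≡y br x≢a = drop-δ a (excess-drop (λ v → δ v a) br x≢a (λ { refl → x≢y b≡y }) λ {v} _ → bound v)
    where
    bound : ∀ v → deg swap v ∸ 2 ≤ deg T v ∸ 2 + δ v a
    bound v = case v ≟ a of λ where
      (yes refl) → excess-suc
      (no v≢a)   → ≤-trans (∸-monoˡ-≤ 2 (deg-shared-≤ b≡y v≢a)) (m≤m+n _ _)

-- Independent sets and stars

allPairs : ∀ {A : Set} {R : A → A → Set} {us} → Unique us →
           (∀ {a b} → a ∈ us → b ∈ us → a ≢ b → R a b) → AllPairs R us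
allPairs [] h = []
allPairs (u∉ ∷ un) h =
  All.tabulate (λ b∈ → h (here refl) (there b∈) (All.lookup u∉ b∈)) ∷ allPairs un (λ a∈ b∈ → h (there a∈) (there b∈))

module _ {G : Graph n} {C : Set} where

  nonadjacent : ∀ u us → All (λ v → Edge G u v → C) us → C ⊎ (∀ {v} → v ∈ us → adj G u v ≡ false)
  nonadjacent u []       []       = inj₂ λ ()
  nonadjacent u (v ∷ us) (h ∷ hs) with edge? {T = G} u v | nonadjacent u us hs
  ... | inj₁ e | _      = inj₁ (h e)
  ... | inj₂ _ | inj₁ c = inj₁ c
  ... | inj₂ f | inj₂ g = inj₂ λ { (here refl) → f ; (there v∈) → g v∈ }

  independent : ∀ us → AllPairs (λ u v → Edge G u v → C) us →
                C ⊎ (∀ {u v} → u ∈ us → v ∈ us → adj G u v ≡ false)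
  independent []       []       = inj₂ λ ()
  independent (u ∷ us) (h ∷ hs) with nonadjacent u us h | independent us hs
  ... | inj₁ c | _      = inj₁ c
  ... | inj₂ _ | inj₁ c = inj₁ c
  ... | inj₂ f | inj₂ g = inj₂ λ where
    (here refl) (here refl) → irrefl G u
    (here refl) (there v∈)  → f v∈
    (there u∈)  (here refl) → trans (adj-sym G _ u) (f u∈)
    (there u∈)  (there v∈)  → g u∈ v∈

  claw : K14Free G → ∀ c {a₁ a₂ a₃ a₄} → let us = a₁ ∷ a₂ ∷ a₃ ∷ a₄ ∷ [] in
         Unique us → All (Edge G c) us → AllPairs (λ u v → Edge G u v → C) us → C
  claw free c {a₁} {a₂} {a₃} {a₄} un es hs with independent _ hs
  ... | inj₁ c = c
  ... | inj₂ f = ⊥-elim (free (c , lookup us , lookup-injective un ,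
                   (λ i → holds (All.lookup es (∈-lookup {xs = us} i))) ,
                   λ i j → f (∈-lookup {xs = us} i) (∈-lookup {xs = us} j)))
    where
    us : List (Fin n)
    us = a₁ ∷ a₂ ∷ a₃ ∷ a₄ ∷ []

spanning-swap : {G T : Graph n} (S : Spanning G T) {x y a b : Fin n} (e : Edge T x y) (oa : On T x y a)
                (ob : On T y x b) → Edge G a b → Spanning G (Swap.swap (Spanning.tree S) e oa ob)
spanning-swap S e oa ob g = record
  { tree = swap-tree
  ; sub  = λ e′ → [ sub ∘ proj₁ , (λ s → transport s g) ]′ (swap⁻ e′) }
  where
  open Spanning S
  open Swap tree e oa ob

-- Exchanges at leaves

-- Goal stands for the existence of the required tree. A configuration is excluded by deriving Goal
-- from it, so the minimality argument needs no decision procedure for Goal.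

module Exchange {n : ℕ} {G : Graph n} (free : K14Free G) {Goal : Set}
                (found : {T : Graph n} → Spanning G T → StemIsPath T → Goal)
                {k : ℕ} (improve : {T : Graph n} → Spanning G T → excess T < k → Goal) where

  -- `k` plays the part of the minimal excess. Exchanges that do not raise the excess lead to
  -- further candidates, so the same lemmas apply again to the exchanged tree.
  record Candidate (T : Graph n) : Set where
    field
      spanning : Spanning G T
      excess≤  : excess T ≤ k
    open Spanning spanning public

  module Shift {T : Graph n} (C : Candidate T) {u x y : Fin n} (l : deg T u ≤ 1)
               (e : Edge T x y) (o : On T x y u) (g : Edge G u y) where
    open Candidate C
    open Swapₚ tree e o ε public

    shifted : Candidate swap
    shifted = record { spanning = spanning-swap spanning e o ε g
                     ; excess≤ = ≤-trans (excess-leaf-≤ l refl) excess≤ }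

    new-leaf : deg T x ≤ 2 → x ≢ u → deg swap x ≤ 1
    new-leaf thin x≢u = ≤-pred (subst (_≤ 2) (sym (deg-x x≢u (edge⇒≢ e))) thin)

  -- Adding `pq` and deleting the edge after the first branch vertex on the way from `q` to `p`
  -- lowers the excess. Without such a vertex the tree is a path, and its stem is empty.
  leaf-leaf : ∀ {T p q} → Candidate T → deg T p ≤ 1 → deg T q ≤ 1 → Edge G p q → Goal
  leaf-leaf {T} {p} {q} C lp lq g
    with search {B = λ v → ¬ IsBranch T v} (λ v → [ inj₁ , inj₂ ]′ (toSum (3 ≤? deg T v)))
  ... | inj₂ none = found (Candidate.spanning C) (stem-empty (Candidate.tree C) none)
  ... | inj₁ (b , br) = cases (clear lq (edge⇒≢ g ∘ sym))
    where
    open Candidate C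
    open Treeₚ tree
    open Climbing tree
    cases : _ ⊎ _ → Goal
    cases (inj₁ (x , e , _ , bare)) with side e b
    ... | inj₁ o = contradiction br (≤⇒≯ (bare b o))
    ... | inj₂ o with refl ← on-leaf (edge-sym e) lp o = contradiction (≤-trans br lp) λ { (s≤s ()) }
    cases (inj₂ (_ , _ , e , br′ , _ , ob , oc)) =
      improve (spanning-swap spanning e ob oc (edge-sym g)) (<-≤-trans (excess-leaves-< lq lp br′) excess≤)
      where open Swapₚ tree e ob oc

  shift-branch : ∀ {T u x y} → Candidate T → deg T u ≤ 1 → Edge T x y → On T x y u → Edge G u y →
                 3 ≤ deg T x → Goal
  shift-branch C l e o g br = improve (Candidate.spanning shifted) (<-≤-trans (excess-leaf-< l refl br) (Candidate.excess≤ C))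
    where open Shift C l e o g

  -- If `x` is neither a branch vertex nor `u`, the shift turns it into a leaf while `z` remains
  -- one, so `leaf-leaf` applies to the shifted tree.
  shift-leaf : ∀ {T u x y z} → Candidate T → deg T u ≤ 1 → Edge T x y → On T x y u → Edge G u y →
               deg T z ≤ 1 → z ≢ u → Edge G z x → Goal
  shift-leaf {T} {u} {x} C l e o g lz z≢u gz with 3 ≤? deg T x | x ≟ u
  ... | yes br | _        = shift-branch C l e o g br
  ... | no _   | yes refl = leaf-leaf C lz l gz
  ... | no ¬br | no x≢u   =
    leaf-leaf shifted (≤-trans (deg-shared-≤ refl z≢u) lz) (new-leaf (≤-pred (≰⇒> ¬br)) x≢u) gz
    where open Shift C l e o g

  module Reattach {T : Graph n} (C : Candidate T) {u x y y′ : Fin n} (l : deg T u ≤ 1)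
                  (e : Edge T x y) (o : On T x y u) (g : Edge G u y)
                  (thin : deg T x ≤ 2) (x≢u : x ≢ u) (e′ : Edge T y y′) (y′≢x : y′ ≢ x) where
    open Candidate C
    open Treeₚ tree
    open Shift C l e o g public

    y′-beyond : On T y x y′
    y′-beyond = on-step (edge-sym e) ε e′ y′≢x

    kept : Edge swap y y′
    kept = swap-keep e′ λ { (inj₁ (refl , _)) → edge⇒≢ e refl ; (inj₂ (_ , y′≡x)) → y′≢x y′≡x }

    -- After the shift `x` hangs from `y` by way of `u`. As a new leaf it can take the place of `u`
    -- in a further shift, at the edge `y y′`.
    x-on : On swap y y′ x
    x-on = Star.map keep (Star.reverse (λ (e , o , o′) → edge-sym e , o′ , o) (inside o))
           ◅◅ (swap-new , (λ { refl → on-excl e o y′-beyond }) , edge⇒≢ e′) ◅ ε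
      where
      keep : ∀ {a b} → Edge T a b × On T x y a × On T x y b → Off swap y′ a b
      keep (ab , oa , ob) =
        swap-keep ab (λ { (inj₁ (_ , b≡y)) → on-≢ e ob b≡y ; (inj₂ (a≡y , _)) → on-≢ e oa a≡y }) ,
        (λ { refl → on-excl e oa y′-beyond }) , λ { refl → on-excl e ob y′-beyond }

  -- Opposite directions are settled by `shift-leaf`. If both leaves charge towards `y`, the star at
  -- `y` with ends `x`, `u`, `v`, `y′` has an adjacency among its ends, and `leaf-leaf` or
  -- `shift-leaf` handles each of the six.
  leaf-clash : ∀ {T u v x y} → Candidate T → deg T u ≤ 1 → deg T v ≤ 1 → u ≢ v → Edge T x y →
               On T x y u → Edge G u y → (On T x y v × Edge G v y) ⊎ (On T y x v × Edge G v x) → Goal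
  leaf-clash C lu lv u≢v e ou gu (inj₂ (_ , gv)) = shift-leaf C lu e ou gu lv (u≢v ∘ sym) gv
  leaf-clash {T} {u} {v} {x} {y} C lu lv u≢v e ou gu (inj₁ (ov , gv)) with 3 ≤? deg T x | deg T y ≤? 1
  ... | yes br | _      = shift-branch C lu e ou gu br
  ... | no _   | yes ly = leaf-leaf C lu ly gu
  ... | no ¬br | no ¬ly with neighbour∉ {T = T} [ x ] (≰⇒> ¬ly)
  ... | y′ , e′ , y′∉ = claw {G = G} free y
      ((x≢u ∷ x≢v ∷ y′≢x ∘ sym ∷ []) ∷ (u≢v ∷ beyond≢ ou ∷ []) ∷ (beyond≢ ov ∷ []) ∷ [] ∷ [])
      (sub (edge-sym e) ∷ edge-sym gu ∷ edge-sym gv ∷ sub e′ ∷ [])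
      (((λ xu → shift-leaf C lv e ov gv lu u≢v (edge-sym xu)) ∷
        (λ xv → shift-leaf C lu e ou gu lv (u≢v ∘ sym) (edge-sym xv)) ∷
        -- In the shifted tree the new leaf `x` charges `y y′`, while the leaf `v` is adjacent to
        -- `y`.
        (λ xy′ → shift-leaf shifted (new-leaf thin x≢u) kept x-on xy′
                   (≤-trans (deg-shared-≤ refl (u≢v ∘ sym)) lv) (x≢v ∘ sym) gv) ∷ []) ∷
       (leaf-leaf C lu lv ∷
        (λ uy′ → shift-leaf C lu e′ (nest e′ e (y′≢x ∘ sym) ou) uy′ lv (u≢v ∘ sym) gv) ∷ []) ∷
       ((λ vy′ → shift-leaf C lv e′ (nest e′ e (y′≢x ∘ sym) ov) vy′ lu u≢v gu) ∷ []) ∷ [] ∷ [])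
    where
    open Candidate C
    open Treeₚ tree
    thin : deg T x ≤ 2
    thin = ≤-pred (≰⇒> ¬br)
    y′≢x : y′ ≢ x
    y′≢x = y′∉ ∘ here
    x≢u : x ≢ u
    x≢u refl = u≢v (sym (on-leaf e lu ov))
    x≢v : x ≢ v
    x≢v refl = u≢v (on-leaf e lv ou)
    beyond≢ : ∀ {w} → On T x y w → w ≢ y′
    beyond≢ ow refl = on-excl e ow (on-step (edge-sym e) ε e′ y′≢x)
    open Reattach C lu e ou gu thin x≢u e′ y′≢x

  -- Trees of excess at most four

  module _ {T : Graph n} (tree : Tree T) (small : excess T ≤ 4) where
    open Treeₚ tree

    module TripodBranches (Y : Tripod tree) where
      open Tripod Y

      centre-deg : 3 ≤ deg T centre
      centre-deg = length≤deg {T = T} {xs = tabulate arm} (Uniqueₚ.tabulate⁺ arm-inj)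
        λ a∈ → case ∈-tabulate⁻ {f = arm} a∈ of λ { (i , refl) → edge-sym (arm-edge i) }

      branches : List (Fin n)
      branches = centre ∷ tabulate tip

      branches-unique : Unique branches
      branches-unique =
        All.tabulate (λ { t∈ refl → case ∈-tabulate⁻ {f = tip} t∈ of λ { (i , c≡) → on-≢ (arm-edge i) (tip-on i) (sym c≡) } }) ∷
        Uniqueₚ.tabulate⁺ λ {i} {j} eq →
          arm-inj (on-unique (arm-edge i) (arm-edge j) (tip-on i) (subst (On T (arm j) centre) (sym eq) (tip-on j)))

      branches-deg : ∀ {v} → v ∈ branches → 1 ≤ deg T v ∸ 2
      branches-deg (here refl) = ∸-monoˡ-≤ 2 centre-deg
      branches-deg (there t∈) with ∈-tabulate⁻ {f = tip} t∈
      ... | i , refl = ∸-monoˡ-≤ 2 (tip-deg i)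

      excess≥4 : 4 ≤ excess T
      excess≥4 = length≤∑ branches-unique branches-deg

      -- The centre and the three tips already account for an excess of 4, which leaves no room for
      -- a fourth edge anywhere.
      deg≤3 : ∀ v → deg T v ≤ 3
      deg≤3 v with 4 ≤? deg T v
      ... | no ¬d = ≤-pred (≰⇒> ¬d)
      ... | yes d = contradiction small (<⇒≱ (begin-strict
          4                                     <⟨ ≤-refl ⟩
          4 + 1                                 ≡⟨ cong₂ _+_ (sym (∑-occ branches)) (sym (∑-δ v)) ⟩
          ∑ (occ branches) + ∑ (λ w → δ w v)    ≡⟨ ∑-+ {n} _ _ ⟨
          ∑ (λ w → occ branches w + δ w v)      ≤⟨ ∑-mono {n} pointwise ⟩
          excess T                              ∎))
        where
        open ≤-Reasoning
        pointwise : ∀ w → occ branches w + δ w v ≤ deg T w ∸ 2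
        pointwise w with w ≟ v
        ... | yes refl = ≤-trans (+-monoˡ-≤ 1 (occ-Unique branches-unique w)) (∸-monoˡ-≤ 2 d)
        ... | no _     = ≤-trans (≤-reflexive (+-identityʳ _)) (occ-≤ branches-unique branches-deg w)

      branch∈ : ∀ {v} → IsBranch T v → v ∈ branches
      branch∈ {v} b with v ∈? branches
      ... | yes v∈ = v∈
      ... | no v∉  = contradiction small (<⇒≱ (length≤∑ (¬Any⇒All¬ _ v∉ ∷ branches-unique)
          λ { (here refl) → ∸-monoˡ-≤ 2 b ; (there w∈) → branches-deg w∈ }))

      arm∈ : ∀ {x} → Edge T x centre → ∃ λ i → x ≡ arm i
      arm∈ {x} e with x ∈? tabulate arm
      ... | yes x∈ = ∈-tabulate⁻ {f = arm} x∈
      ... | no x∉  = contradiction (deg≤3 centre) (<⇒≱ (length≤deg {T = T} (¬Any⇒All¬ _ x∉ ∷ Uniqueₚ.tabulate⁺ arm-inj)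
          λ { (here refl) → edge-sym e ; (there a∈) → case ∈-tabulate⁻ {f = arm} a∈ of λ { (i , refl) → edge-sym (arm-edge i) } }))

  -- The part of being a centre that survives the exchanges below and that `centre-leaf` relies on;
  -- `Centre` adds that no direction has two branch vertices.
  record Full (T : Graph n) (r : Fin n) : Set where
    field
      r-deg : 3 ≤ deg T r
      full  : ∀ {x} → Edge T x r → ∃ λ s → IsBranch T s × On T x r s

  record Centre (T : Graph n) (r : Fin n) : Set where
    field
      isFull : Full T r
      single : ∀ {c s s′} → Edge T c r → On T c r s → On T c r s′ → IsBranch T s → IsBranch T s′ → s ≡ s′
    open Full isFull public

  tripod-centre : ∀ {T} (tree : Tree T) → excess T ≤ 4 → (Y : Tripod tree) → Centre T (Tripod.centre Y)
  tripod-centre {T} tree small Y = record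
    { isFull = record { r-deg = centre-deg ; full = λ e → case arm∈ e of λ { (i , refl) → tip i , tip-deg i , tip-on i } }
    ; single = single }
    where
    open Treeₚ tree
    open Tripod Y
    open TripodBranches tree small Y
    single : ∀ {c s s′} → Edge T c centre → On T c centre s → On T c centre s′ → IsBranch T s → IsBranch T s′ → s ≡ s′
    single e o o′ b b′ with branch∈ b | branch∈ b′
    ... | here refl | _         = contradiction refl (on-≢ e o)
    ... | _         | here refl = contradiction refl (on-≢ e o′)
    ... | there t∈  | there t∈′ with ∈-tabulate⁻ {f = tip} t∈ | ∈-tabulate⁻ {f = tip} t∈′
    ... | i , refl | j , refl = cong tip (arm-inj
      (trans (on-unique (arm-edge i) e (tip-on i) o) (on-unique e (arm-edge j) o′ (tip-on j))))

  deg-4 : ∀ {T v} → Spanning G T → excess T ≤ 4 → 4 ≤ deg T v → Goal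
  deg-4 {v = v} S small d with stem-or-tripod (Spanning.tree S)
  ... | inj₁ stem = found S stem
  ... | inj₂ Y    = contradiction (TripodBranches.deg≤3 (Spanning.tree S) small Y v) (<⇒≱ d)

  -- With excess at most 4, a tripod centre has no direction besides its three arms, and each of
  -- these contains a branch vertex.
  bare-everywhere : ∀ {T} → Spanning G T → excess T ≤ 4 →
                    (∀ {s} → IsBranch T s → ∃ λ d → Edge T d s × Bare T d s) → Goal
  bare-everywhere S small h with stem-or-tripod (Spanning.tree S)
  ... | inj₁ stem = found S stem
  ... | inj₂ Y with h (Centre.r-deg (tripod-centre (Spanning.tree S) small Y))
  ... | d , e , bare with Centre.full (tripod-centre (Spanning.tree S) small Y) e
  ... | s , b , o = contradiction b (≤⇒≯ (bare s o))

-- Conflicts between the centre and a leaf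

module Central {n : ℕ} {G : Graph n} (free : K14Free G) {Goal : Set}
               (found : {T : Graph n} → Spanning G T → StemIsPath T → Goal)
               {k : ℕ} (improve : {T : Graph n} → Spanning G T → excess T < k → Goal) (k≤4 : k ≤ 4) where
  open Exchange free found improve

  -- As `r` is full, a branch vertex `b` precedes it on the way from `u`. Exchanging the edge after
  -- `b` for `ur` moves one unit of excess from `b` to `r`; if that edge ends at `r`, `b` alone
  -- changes its excess, and the total drops.
  centre-leaf : ∀ {T r u} → Candidate T → Full T r → deg T u ≤ 1 → Edge G u r → Goal
  centre-leaf {T} {r} {u} C F l g = cases (clear l (edge⇒≢ g))
    where
    open Candidate C
    open Full F
    open Climbing tree
    cases : _ ⊎ _ → Goal
    cases (inj₁ (_ , e , _ , bare)) = let s , b , o = full e in contradiction b (≤⇒≯ (bare s o))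
    cases (inj₂ (b , c , e , br , b≢r , ob , oc)) with c ≟ r
    ... | yes refl = shift-branch C l e ob g br
    ... | no c≢r   = deg-4 (spanning-swap spanning e ob oc g)
        (≤-trans (excess-gain-b l br b≢r) (≤-trans excess≤ k≤4))
        (subst (4 ≤_) (sym (deg-b (b≢r ∘ sym) (c≢r ∘ sym))) (s≤s r-deg))
      where open Swapₚ tree e ob oc

  module _ {T : Graph n} (C : Candidate T) {r u x y : Fin n} (l : deg T u ≤ 1)
           (e : Edge T x y) (x≢r : x ≢ r) (or : On T x y r) where
    open Candidate C
    open Treeₚ tree
    open Climbing tree

    private
      r≢y : r ≢ y
      r≢y = on-≢ e or

    -- Exchanging `yx` for `ux` makes `y` a leaf adjacent to `r`. Both `yx` and its replacement
    -- avoid `r`, so walks away from `r` can be rerouted away from `r`, and `r` stays full.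
    clash-below : Full T r → On T y x u → Edge G u x → Edge G r y → Goal
    clash-below F ou gu gr with y ≟ u | 3 ≤? deg T y
    ... | yes refl | _      = centre-leaf C F l (edge-sym gr)
    ... | no _     | yes br = shift-branch C l (edge-sym e) ou gu br
    ... | no y≢u   | no ¬br = centre-leaf shifted full′ (new-leaf thin y≢u) (edge-sym gr)
      where
      open Full F
      open Shift C l (edge-sym e) ou gu
      thin : deg T y ≤ 2
      thin = ≤-pred (≰⇒> ¬br)
      u≢r : u ≢ r
      u≢r refl = contradiction (≤-trans r-deg l) λ { (s≤s ()) }
      branch′ : ∀ {s} → IsBranch T s → IsBranch swap s
      branch′ b = ≤-trans b (deg-shared-≥ refl λ { refl → ¬br b })
      y⇝x : Star (Off swap r) y x
      y⇝x = Star.map keep (Star.reverse (λ (e , o , o′) → edge-sym e , o′ , o) (inside ou)) ◅◅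
            (swap-new , u≢r , x≢r) ◅ ε
        where
        keep : ∀ {a b} → Edge T a b × On T y x a × On T y x b → Off swap r a b
        keep (ab , oa , ob) =
          swap-keep ab (λ { (inj₁ (_ , b≡x)) → on-≢ (edge-sym e) ob b≡x ; (inj₂ (a≡x , _)) → on-≢ (edge-sym e) oa a≡x }) ,
          (λ { refl → on-excl e or oa }) , λ { refl → on-excl e or ob }
      replace : ∀ {p q} → Off T r p q → Star (Off swap r) p q
      replace {p} {q} (pq , p≢r , q≢r) with sameEdge? y x p q
      ... | yes (inj₁ (refl , refl)) = y⇝x
      ... | yes (inj₂ (refl , refl)) = off-sym y⇝x
      ... | no ¬s                    = (swap-keep pq ¬s , p≢r , q≢r) ◅ ε
      old : ∀ {z} → Edge swap z r → Edge T z r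
      old e′ with swap⁻ e′
      ... | inj₁ (et , _)          = et
      ... | inj₂ (inj₁ (_ , r≡x)) = contradiction (sym r≡x) x≢r
      ... | inj₂ (inj₂ (_ , r≡u)) = contradiction (sym r≡u) u≢r
      full′ : Full swap r
      full′ = record
        { r-deg = branch′ r-deg
        ; full  = λ e′ → let s , b , o = full (old e′) in s , branch′ b , (replace Star.⋆) o }

    -- Exchanging xy for uy leaves at every branch vertex a direction without branch vertices: at r
    -- the direction of x, elsewhere one that leads neither to r nor to u.
    clash-across : ∀ {s₀} → Centre T r → On T x y u → Edge G u y → IsBranch T s₀ → On T y x s₀ → Goal
    clash-across {s₀} D ou gu b₀ os₀ with 3 ≤? deg T x
    ... | yes br = shift-branch C l e ou gu br
    ... | no ¬br with toward x≢r
    ... | c , ec , ocx = bare-everywhere (Candidate.spanning shifted) (≤-trans (Candidate.excess≤ shifted) k≤4) bare-at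
      where
      open Centre D
      open Shift C l e ou gu
      pull : ∀ {R : Fin n → Fin n → Set} {P : Fin n → Set} → (∀ {a b} → R a b → P b → P a) →
             ∀ {w z} → Star R w z → P z → P w
      pull h ε       p = p
      pull h (r ◅ w) p = h r (pull h w p)
      leaf-branch : ∀ {v} → IsBranch T v → v ≢ u
      leaf-branch b refl = contradiction (≤-trans b l) λ { (s≤s ()) }
      ocy : On T c r y
      ocy = on-step ec ocx e (r≢y ∘ sym)
      ocs₀ : On T c r s₀
      ocs₀ = on-avoid (edge-sym e) os₀ or ◅◅ ocy
      u≢r : u ≢ r
      u≢r = leaf-branch r-deg ∘ sym
      -- If `u` lay in the direction of `c`, its first branch vertex on the way to `r` would be
      -- `s₀`, the only one in that direction. But `u` and `r` are on the same side of `xy` and `s₀`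
      -- is on the other.
      ¬ocu : ¬ On T c r u
      ¬ocu ocu with clear l u≢r
      ... | inj₁ (_ , e₁ , _ , bare) = let s , b , o = full e₁ in contradiction b (≤⇒≯ (bare s o))
      ... | inj₂ (b , c′ , e′ , br , b≢r , ob , oc′)
        with refl ← single ec (off-sym (on-avoid e′ ob oc′) ◅◅ ocu) ocs₀ br b₀ =
        on-excl e′ ob (on-avoid e ou os₀ ◅◅ off-sym (on-avoid e or os₀) ◅◅ oc′)
      escape : ∀ {c z s} → Edge T c r → On T c r z → On T r c s → r ≢ s → Star (Off T s) z r
      escape ec oz os r≢s = on-avoid ec oz os ◅◅ (ec , (λ { refl → on-≢ (edge-sym ec) os refl }) , r≢s) ◅ ε
      thinned : ∀ {z} → z ≢ u → ¬ IsBranch T z → deg swap z ≤ 2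
      thinned z≢u ¬b = ≤-trans (deg-shared-≤ refl z≢u) (≤-pred (≰⇒> ¬b))
      -- Deleting `xy` cuts `s₀` off from the direction of `c`, and the new edge at `u` does not
      -- lead back into it.
      at-r : Edge swap c r × Bare swap c r
      at-r = swap-keep ec (λ { (inj₁ (_ , r≡y)) → r≢y r≡y ; (inj₂ (_ , r≡x)) → x≢r (sym r≡x) }) , bare
        where
        oxc : On T x y c
        oxc = on-step e or (edge-sym ec) λ { refl → x≢r (on-unique e (edge-sym ec) or ε) }
        stay : ∀ {a b} → Off swap r a b → On T c r b × On T x y b → On T c r a × On T x y a
        stay (ab , a≢r , _) (ob , oxb) with swap⁻ ab
        ... | inj₁ (et , ¬s) = on-step ec ob (edge-sym et) a≢r ,
          on-step e oxb (edge-sym et) λ { refl → ¬s (inj₂ (refl , proj₁ (on-cross e (edge-sym et) oxb ε))) }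
        ... | inj₂ (inj₁ (_ , b≡y))    = contradiction b≡y (on-≢ e oxb)
        ... | inj₂ (inj₂ (_ , refl)) = contradiction ob ¬ocu
        bare : Bare swap c r
        bare z o with pull stay o (ε , oxc)
        ... | oz , oxz = thinned (λ { refl → ¬ocu oz })
          λ b → on-excl e oxz (subst (On T y x) (sym (single ec oz ocs₀ b b₀)) os₀)
      at-other : ∀ {s} → IsBranch T s → r ≢ s → ∃ λ d → Edge swap d s × Bare swap d s
      at-other {s} bs r≢s with toward r≢s | toward (leaf-branch bs ∘ sym)
      ... | pr , er , opr | pu , eu , opu with neighbour∉ {T = T} (pr ∷ pu ∷ []) bs
      ... | d , es , d∉ = d , swap-keep ed (λ { (inj₁ (refl , refl)) → ¬odx ε ; (inj₂ (_ , refl)) → ¬br bs }) , bare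
        where
        ed : Edge T d s
        ed = edge-sym es
        ¬od : ∀ {z} → Star (Off T s) z r → ¬ On T d s z
        ¬od w o = d∉ (here (on-unique ed er o (w ◅◅ opr)))
        ¬odu : ¬ On T d s u
        ¬odu o = d∉ (there (here (on-unique ed eu o opu)))
        -- `s` never separates `x` from `r`: the only branch vertex in the direction of `c` is `s₀`,
        -- which lies beyond `y`.
        x⇝r : Star (Off T s) x r
        x⇝r with side e s | side ec s
        ... | inj₂ oy | _       = off-sym (on-avoid e or oy)
        ... | inj₁ ox | inj₂ o  = escape ec ocx o r≢s
        ... | inj₁ ox | inj₁ o  = ⊥-elim (on-excl e ox (subst (On T y x) (sym (single ec o ocs₀ bs b₀)) os₀))
        ¬odx : ¬ On T d s x
        ¬odx = ¬od x⇝r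
        ¬ody : ¬ On T d s y
        ¬ody o = ¬odx (on-step ed o (edge-sym e) λ { refl → ¬br bs })
        stay : ∀ {a b} → Off swap s a b → On T d s b → On T d s a
        stay (ab , a≢s , _) ob with swap⁻ ab
        ... | inj₁ (et , _)          = on-step ed ob (edge-sym et) a≢s
        ... | inj₂ (inj₁ (_ , refl)) = contradiction ob ¬ody
        ... | inj₂ (inj₂ (_ , refl)) = contradiction ob ¬odu
        bare : Bare swap d s
        bare z o′ = thinned (λ { refl → ¬odu o }) ¬bz
          where
          o : On T d s z
          o = pull stay o′ ε
          ¬bz : ¬ IsBranch T z
          ¬bz bz with z ≟ r
          ... | yes refl = ¬od ε o
          ... | no z≢r with toward z≢r
          ... | cz , ecz , ocz with side ecz s
          ... | inj₁ os = on-≢ ed o (single ecz ocz os bz bs)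
          ... | inj₂ os = ¬od (escape ecz ocz os r≢s) o
      bare-at : ∀ {s} → IsBranch swap s → ∃ λ d → Edge swap d s × Bare swap d s
      bare-at {s} b′ with r ≟ s
      ... | yes refl = c , at-r
      ... | no r≢s   = at-other (≤-trans b′ (deg-shared-≤ refl s≢u)) r≢s
        where
        s≢u : s ≢ u
        s≢u refl = contradiction (≤-trans b′ (≤-trans deg-≤suc (s≤s l))) λ { (s≤s (s≤s ())) }

    -- The star at `y` has the ends `r`, `u`, `x`, `y′`. The adjacencies `ru`, `rx`, `uy′`, `xy′`
    -- lead, at once or after shifts, to a leaf adjacent to `r`; `ux` and `ry′` lead to degree 4 at
    -- `r` or to a smaller excess.
    clash-bare : Full T r → On T x y u → Edge G u y → Edge G r y → Bare T y x → Goal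
    clash-bare F ou gu gr bare with 3 ≤? deg T x | deg T y ≤? 1
    ... | yes br | _      = shift-branch C l e ou gu br
    ... | no _   | yes ly = centre-leaf C F ly (edge-sym gr)
    ... | no ¬br | no ¬ly with neighbour∉ {T = T} [ x ] (≰⇒> ¬ly)
    ... | y′ , e′ , y′∉ = claw {G = G} free y
        ((u≢r ∘ sym ∷ x≢r ∘ sym ∷ beyond≢ or ∷ []) ∷ (x≢u ∘ sym ∷ beyond≢ ou ∷ []) ∷ (y′≢x ∘ sym ∷ []) ∷ [] ∷ [])
        (edge-sym gr ∷ edge-sym gu ∷ sub (edge-sym e) ∷ sub e′ ∷ [])
        ((centre-leaf C F l ∘ edge-sym ∷ r~x ∷ r~y′ ∷ []) ∷ (u~x ∷ u~y′ ∷ []) ∷ (x~y′ ∷ []) ∷ [] ∷ [])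
      where
      open Full F
      thin : deg T x ≤ 2
      thin = ≤-pred (≰⇒> ¬br)
      thin-y : deg T y ≤ 2
      thin-y = bare y ε
      y′≢x : y′ ≢ x
      y′≢x = y′∉ ∘ here
      u≢r : u ≢ r
      u≢r refl = contradiction (≤-trans r-deg l) λ { (s≤s ()) }
      x≢u : x ≢ u
      x≢u refl = x≢r (sym (on-leaf e l or))
      beyond : On T y x y′
      beyond = on-step (edge-sym e) ε e′ y′≢x
      beyond≢ : ∀ {w} → On T x y w → w ≢ y′
      beyond≢ ow refl = on-excl e ow beyond
      u≢y : u ≢ y
      u≢y = on-≢ e ou

      -- The side of `y` is bare, so the branch vertices that make `r` full are on the side of `x`.
      -- Excursions across `xy` can be cut out of walks between vertices of that side, so it is
      -- enough to keep the edges inside it.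
      full-stays : ∀ {T′} → (∀ {p q} → Edge T p q → On T x y p → On T x y q → Edge T′ p q) →
                   (∀ {z} → Edge T′ z r → Edge T z r) → (∀ {s} → IsBranch T s → IsBranch T′ s) → Full T′ r
      full-stays {T′} keep old branch′ = record { r-deg = branch′ r-deg ; full = full′ }
        where
        prune : ∀ {a z} → On T x y z → Star (Off T r) a z →
                (On T x y a → Star (Off T′ r) a z) × (On T y x a → Star (Off T′ r) x z)
        prune oz ε = (λ _ → ε) , λ o → ⊥-elim (on-excl e oz o)
        prune oz (_◅_ {j = b} (ab , a≢r , b≢r) w) with prune oz w | side e b
        ... | near , _  | inj₁ ob = (λ oa → (keep ab oa ob , a≢r , b≢r) ◅ near ob) ,
                                    λ oa → case on-cross (edge-sym e) ab oa ob of λ { (_ , refl) → near ob }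
        ... | _ , far   | inj₂ ob = (λ oa → case on-cross e ab oa ob of λ { (refl , _) → far ob }) , λ _ → far ob
        full′ : ∀ {z} → Edge T′ z r → ∃ λ s → IsBranch T′ s × On T′ z r s
        full′ {z} ez′ with full (old ez′)
        ... | s , b , o with side e s
        ... | inj₂ os = contradiction b (≤⇒≯ (bare s os))
        ... | inj₁ os = s , branch′ b , proj₁ (prune oz o) os
          where
          oz : On T x y z
          oz = on-step e or (edge-sym (old ez′)) λ { refl → x≢r (on-unique e (edge-sym (old ez′)) or ε) }

      module A = Reattach C l e ou gu thin x≢u e′ y′≢x

      keepA : ∀ {p q} → Edge T p q → On T x y p → On T x y q → Edge A.swap p q
      keepA pq op oq = A.swap-keep pq λ { (inj₁ (_ , q≡y)) → on-≢ e oq q≡y ; (inj₂ (p≡y , _)) → on-≢ e op p≡y }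
      oldA : ∀ {z} → Edge A.swap z r → Edge T z r
      oldA ez with A.swap⁻ ez
      ... | inj₁ (ez , _)         = ez
      ... | inj₂ (inj₁ (_ , r≡y)) = contradiction r≡y r≢y
      ... | inj₂ (inj₂ (_ , r≡u)) = contradiction (sym r≡u) u≢r
      branchA : ∀ {s} → IsBranch T s → IsBranch A.swap s
      branchA b = ≤-trans b (A.deg-shared-≥ refl λ { refl → ¬br b })

      r~x : Edge G r x → Goal
      r~x rx = centre-leaf A.shifted (full-stays keepA oldA branchA) (A.new-leaf thin x≢u) (edge-sym rx)

      u~y′ : Edge G u y′ → Goal
      u~y′ uy′ = centre-leaf B.shifted (full-stays keep old branch′) (B.new-leaf thin-y (u≢y ∘ sym)) (edge-sym gr)
        where
        module B = Shift C l e′ (nest e′ e (y′≢x ∘ sym) ou) uy′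
        keep : ∀ {p q} → Edge T p q → On T x y p → On T x y q → Edge B.swap p q
        keep pq op oq = B.swap-keep pq λ { (inj₁ (p≡y , _)) → on-≢ e op p≡y ; (inj₂ (_ , q≡y)) → on-≢ e oq q≡y }
        old : ∀ {z} → Edge B.swap z r → Edge T z r
        old ez with B.swap⁻ ez
        ... | inj₁ (ez , _)          = ez
        ... | inj₂ (inj₁ (_ , r≡y′)) = contradiction r≡y′ (beyond≢ or)
        ... | inj₂ (inj₂ (_ , r≡u))  = contradiction (sym r≡u) u≢r
        branch′ : ∀ {s} → IsBranch T s → IsBranch B.swap s
        branch′ b = ≤-trans b (B.deg-shared-≥ refl λ { refl → contradiction b (≤⇒≯ thin-y) })

      x~y′ : Edge G x y′ → Goal
      x~y′ xy′ = centre-leaf B.shifted (full-stays keep old branch′)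
          (B.new-leaf (≤-trans (A.deg-shared-≤ refl (u≢y ∘ sym)) thin-y) (edge⇒≢ e ∘ sym)) (edge-sym gr)
        where
        module B = Shift A.shifted (A.new-leaf thin x≢u) A.kept A.x-on xy′
        keep : ∀ {p q} → Edge T p q → On T x y p → On T x y q → Edge B.swap p q
        keep pq op oq = B.swap-keep (keepA pq op oq)
          λ { (inj₁ (p≡y , _)) → on-≢ e op p≡y ; (inj₂ (_ , q≡y)) → on-≢ e oq q≡y }
        old : ∀ {z} → Edge B.swap z r → Edge T z r
        old ez with B.swap⁻ ez
        ... | inj₁ (ez , _)          = oldA ez
        ... | inj₂ (inj₁ (_ , r≡y′)) = contradiction r≡y′ (beyond≢ or)
        ... | inj₂ (inj₂ (_ , r≡x))  = contradiction (sym r≡x) x≢r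
        branch′ : ∀ {s} → IsBranch T s → IsBranch B.swap s
        branch′ b = ≤-trans (branchA b) (B.deg-shared-≥ refl λ { refl → contradiction b (≤⇒≯ thin-y) })

      -- p* is the first branch vertex before x on the way from r, and q* the vertex after it.
      open Climb (climb (direct (connected x r)) (edge-sym e) or bare)

      -- The side of `q*` is bare, whereas every direction at `r` contains a branch vertex.
      p*≢r : p* ≢ r
      p*≢r p≡r = let s , b , o = full (subst (Edge T q*) p≡r edge*) in
        contradiction b (≤⇒≯ (bare* s (subst (λ v → On T q* v s) (sym p≡r) o)))
      p*-branch : IsBranch T p*
      p*-branch = [ (λ p*≡r → contradiction p*≡r p*≢r) , id ]′ stop
      p*≢x : p* ≢ x
      p*≢x p≡x = ¬br (subst (IsBranch T) p≡x p*-branch)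
      p*≢y : p* ≢ y
      p*≢y p≡y = contradiction (subst (IsBranch T) p≡y p*-branch) (≤⇒≯ thin-y)
      q*≢r : q* ≢ r
      q*≢r q≡r = on-excl edge* (subst (On T q* p*) q≡r ε) target*
      u-on : On T p* q* u
      u-on = leaves* l ou
      x-on : On T q* p* x
      x-on = swallow thin x≢r
      y-on : On T q* p* y
      y-on = grow ε
      q*≢y : q* ≢ y
      q*≢y q≡y = p*≢x (on-unique (subst (Edge T p*) q≡y (edge-sym edge*)) e (subst (λ q → On T p* q r) q≡y target*) or)

      -- After exchanging p*q* for uw, both r and u are still joined to p* away from q*.
      module Detach {w : Fin n} (ow : On T q* p* w) (guw : Edge G u w) (p*≢w : p* ≢ w) where
        open Swapₚ tree (edge-sym edge*) u-on ow public

        detached : Spanning G swap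
        detached = spanning-swap spanning (edge-sym edge*) u-on ow guw

        excess-detached : excess swap ≤ 4
        excess-detached = ≤-trans (excess-gain-b l p*-branch p*≢w) (≤-trans excess≤ k≤4)

        r⇝w : ∀ {v} → On T q* p* v → v ≢ w → Star (Off swap v) r w
        r⇝w {v} ov v≢w = Star.map keep (inside target*) ◅◅
                         Star.map keep (Star.reverse (λ (ab , oa , ob) → edge-sym ab , ob , oa) (inside u-on)) ◅◅
                         (swap-new , u≢v , v≢w ∘ sym) ◅ ε
          where
          keep : ∀ {a b} → Edge T a b × On T p* q* a × On T p* q* b → Off swap v a b
          keep (ab , oa , ob) =
            swap-keep ab (λ { (inj₁ (_ , b≡q)) → on-≢ (edge-sym edge*) ob b≡q ; (inj₂ (a≡q , _)) → on-≢ (edge-sym edge*) oa a≡q }) ,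
            (λ { refl → on-excl edge* ov oa }) , λ { refl → on-excl edge* ov ob }
          u≢v : u ≢ v
          u≢v refl = on-excl edge* ov u-on

        deg-w : w ≢ q* → deg swap w ≡ suc (deg T w)
        deg-w = deg-b (p*≢w ∘ sym)

        -- A second exchange, of `wv` for `rv`. The first took an edge from `p*` and gave one to
        -- `w`, which now has degree at least 3 and can pay for the fourth edge at `r`.
        deg-4′ : ∀ {v} (f : Edge swap w v) (o : On swap w v r) → Edge G r v → 3 ≤ deg swap w → w ≢ r → r ≢ v → Goal
        deg-4′ f o g b w≢r r≢v = deg-4 (spanning-swap detached f o ε g)
            (≤-trans (S.excess-gain-a refl b w≢r) excess-detached)
            (subst (4 ≤_) (sym (S.deg-a (w≢r ∘ sym) r≢v)) (s≤s (≤-trans r-deg (deg-≥ (p*≢r ∘ sym) (q*≢r ∘ sym)))))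
          where module S = Swapₚ swap-tree f o ε

      u~x : Edge G u x → Goal
      u~x gux with q* ≟ x
      ... | yes q≡x = shift-branch C l (edge-sym edge*) u-on (subst (Edge G u) (sym q≡x) gux) p*-branch
      ... | no q*≢x  = deg-4′ kept (r⇝w y-on (edge⇒≢ e ∘ sym)) gr
          (subst (3 ≤_) (sym (deg-w (q*≢x ∘ sym))) (s≤s x-deg)) x≢r r≢y
        where
        open Detach x-on gux p*≢x
        kept : Edge swap x y
        kept = swap-keep e λ { (inj₁ (x≡p , _)) → p*≢x (sym x≡p) ; (inj₂ (x≡q , _)) → q*≢x (sym x≡q) }
        x-deg : 2 ≤ deg T x
        x-deg with enter (x≢u ∘ sym) ou
        ... | w , (ew , w≢y , _) , _ = two-neighbours (edge-sym ew) e w≢y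

      r~y′ : Edge G r y′ → Goal
      r~y′ gry′ = deg-4′ kept (r⇝w (grow beyond) (edge⇒≢ e′ ∘ sym)) gry′
          (subst (3 ≤_) (sym (deg-w (q*≢y ∘ sym))) (s≤s (≰⇒> ¬ly))) (r≢y ∘ sym) (beyond≢ or)
        where
        open Detach y-on gu p*≢y
        kept : Edge swap y y′
        kept = swap-keep e′ λ { (inj₁ (y≡p , _)) → p*≢y (sym y≡p) ; (inj₂ (y≡q , _)) → q*≢y (sym y≡q) }

  centre-clash : ∀ {T r u x y} → Candidate T → Centre T r → deg T u ≤ 1 → Edge T x y → On T x y r → Edge G r y →
                 (On T x y u × Edge G u y) ⊎ (On T y x u × Edge G u x) → Goal
  centre-clash {T} {r} {u} {x} {y} C D l e or gr h with x ≟ r | h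
  ... | yes refl | inj₁ (ou , gu) = shift-branch C l e ou gu (Centre.r-deg D)
  ... | yes refl | inj₂ (_ , gu)  = centre-leaf C (Centre.isFull D) l gu
  ... | no x≢r   | inj₂ (ou , gu) = clash-below C l e x≢r or (Centre.isFull D) ou gu gr
  ... | no x≢r   | inj₁ (ou , gu)
    with search {A = λ s → IsBranch T s × On T y x s} {B = λ s → On T y x s → deg T s ≤ 2} branch?
    where
    branch? : ∀ s → (IsBranch T s × On T y x s) ⊎ (On T y x s → deg T s ≤ 2)
    branch? s with 3 ≤? deg T s | Treeₚ.side (Candidate.tree C) e s
    ... | no ¬b | _      = inj₂ λ _ → ≤-pred (≰⇒> ¬b)
    ... | yes b | inj₂ o = inj₁ (b , o)
    ... | yes b | inj₁ o = inj₂ λ o′ → ⊥-elim (Treeₚ.on-excl (Candidate.tree C) e o o′)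
  ... | inj₁ (s , b , o) = clash-across C l e x≢r or D ou gu b o
  ... | inj₂ bare        = clash-bare C l e x≢r or (Centre.isFull D) ou gu gr bare

-- Seven independent vertices

module _ {n : ℕ} {G : Graph n} (σ : σ≥ G 7 n) {Goal : Set} where

  σ-list : ∀ us → length us ≡ 7 → Unique us → (∀ {u v} → u ∈ us → v ∈ us → adj G u v ≡ false) →
           n ≤ sum (map (deg G) us)
  σ-list us@(_ ∷ _ ∷ _ ∷ _ ∷ _ ∷ _ ∷ _ ∷ []) refl un h =
    σ (lookup us) (lookup-injective un , λ i j → h (∈-lookup {xs = us} i) (∈-lookup {xs = us} j))

  seven : ∀ {T} → Spanning G T → Fin n → ∀ us → length us ≡ 7 → Unique us →
          (∀ {u v} → u ∈ us → v ∈ us → u ≢ v → Edge G u v → Goal) →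
          (∀ {u v x y} → u ∈ us → v ∈ us → u ≢ v → Edge T x y → On T x y u → Edge G u y →
             (On T x y v × Edge G v y) ⊎ (On T y x v × Edge G v x) → Goal) → Goal
  seven S ρ us len un adjacent clash
    with independent {G = G} us (allPairs un adjacent) | degree-sum S ρ us un clash
  ... | inj₁ goal | _         = goal
  ... | inj₂ _    | inj₁ goal = goal
  ... | inj₂ ind  | inj₂ less = contradiction (σ-list us len un ind) (<⇒≱ less)

some-leaves : ∀ m (T : Graph n) → m ≤ length (leaves T) →
              ∃ λ us → length us ≡ m × Unique us × (∀ {u} → u ∈ us → deg T u ≤ 1)
some-leaves {n} m T le =
  take m (leaves T) , trans (length-take m (leaves T)) (m≤n⇒m⊓n≡m le) ,
  Uniqueₚ.take⁺ m (Uniqueₚ.filter⁺ leaf? (Uniqueₚ.allFin⁺ n)) ,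
  λ u∈ → proj₂ (∈-filter⁻ leaf? {xs = allFin n} (take⊆ m (leaves T) u∈))
  where
  leaf? : ∀ v → Dec (deg T v ≤ 1)
  leaf? v = deg T v ≤? 1
  take⊆ : ∀ {A : Set} m (xs : List A) {x} → x ∈ take m xs → x ∈ xs
  take⊆ (suc m) (x ∷ xs) (here eq)  = here eq
  take⊆ (suc m) (x ∷ xs) (there x∈) = there (take⊆ m xs x∈)

-- Induction on the excess

module _ {n : ℕ} {G : Graph n} (free : K14Free G) (σ : σ≥ G 7 n) {Goal : Set}
         (found : {T : Graph n} → Spanning G T → StemIsPath T → Goal) where

  -- No minimal tree is ever chosen: the given tree is treated as if it were minimal, and every
  -- exchange that lowers the excess is passed to the induction hypothesis.
  improve : ∀ k {T : Graph n} → Spanning G T → excess T < k → Goal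
  improve (suc k) {T} S (s≤s ≤k) with stem-or-tripod (Spanning.tree S)
  ... | inj₁ stem = found S stem
  ... | inj₂ Y    = case excess T ≤? 4 of λ { (yes small) → few small ; (no ¬small) → many (≰⇒> ¬small) }
    where
    smaller : {T′ : Graph n} → Spanning G T′ → excess T′ < excess T → Goal
    smaller S′ less = improve k S′ (<-≤-trans less ≤k)
    open Exchange free found smaller
    ρ : Fin n
    ρ = Tripod.tip Y zero
    open Rooted (Spanning.tree S) ρ
    C : Candidate T
    C = record { spanning = S ; excess≤ = ≤-refl }

    many : 5 ≤ excess T → Goal
    -- Seven is `5 + 2`. In `few` the four branch vertices of the tripod give `4 + 2` leaves, and
    -- `r` is the seventh vertex.
    many 5≤ with some-leaves 7 T (≤-trans (+-monoˡ-≤ 2 5≤) (excess+2≤leaves (Tripod.tip-deg Y zero)))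
    ... | us , len , un , leaf = seven σ S ρ us len un
      (λ u∈ v∈ _ → leaf-leaf C (leaf u∈) (leaf v∈))
      (λ u∈ v∈ → leaf-clash C (leaf u∈) (leaf v∈))

    few : excess T ≤ 4 → Goal
    few small with some-leaves 6 T (≤-trans (+-monoˡ-≤ 2 (TripodBranches.excess≥4 (Spanning.tree S) small Y))
                                            (excess+2≤leaves (Tripod.tip-deg Y zero)))
    ... | us , len , un , leaf = seven σ S ρ (r ∷ us) (cong suc len) (¬Any⇒All¬ _ r∉ ∷ un) adjacent clash
      where
      open Central free found smaller small
      r : Fin n
      r = Tripod.centre Y
      D : Centre T r
      D = tripod-centre (Spanning.tree S) small Y
      open Centre D
      r∉ : r ∉ us
      r∉ r∈ = contradiction (≤-trans r-deg (leaf r∈)) λ { (s≤s ()) }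
      adjacent : ∀ {u v} → u ∈ r ∷ us → v ∈ r ∷ us → u ≢ v → Edge G u v → Goal
      adjacent (here refl) (here refl) u≢v _ = contradiction refl u≢v
      adjacent (here refl) (there v∈)  _   g = centre-leaf C isFull (leaf v∈) (edge-sym g)
      adjacent (there u∈)  (here refl) _   g = centre-leaf C isFull (leaf u∈) g
      adjacent (there u∈)  (there v∈)  _   g = leaf-leaf C (leaf u∈) (leaf v∈) g
      clash : ∀ {u v x y} → u ∈ r ∷ us → v ∈ r ∷ us → u ≢ v → Edge T x y → On T x y u → Edge G u y →
              (On T x y v × Edge G v y) ⊎ (On T y x v × Edge G v x) → Goal
      clash (here refl) (here refl) u≢v _ _ _ _ = contradiction refl u≢v
      clash (here refl) (there v∈)  _   e o g h = centre-clash C D (leaf v∈) e o g h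
      -- The arguments are rearranged so that `r` comes first; for opposite directions this also
      -- reverses the edge.
      clash (there u∈)  (here refl) _   e o g (inj₁ (o′ , g′)) = centre-clash C D (leaf u∈) e o′ g′ (inj₁ (o , g))
      clash (there u∈)  (here refl) _   e o g (inj₂ (o′ , g′)) = centre-clash C D (leaf u∈) (edge-sym e) o′ g′ (inj₂ (o , g))
      clash (there u∈)  (there v∈)  u≢v e o g h = leaf-clash C (leaf u∈) (leaf v∈) u≢v e o g h

theorem1p7 : (n : ℕ) (G : Graph n) → Connected G → K14Free G → σ≥ G 7 n →
    Σ (Graph n) (λ T → IsSpanningTree T G × StemIsPath T)
theorem1p7 n G conn free σ with spanning-tree (λ u v → let ws , walk = conn u v in walk⇒star ws walk)
... | T , S = improve free σ
  (λ {T} S stem → T , ((λ u v e → holds (Spanning.sub S (edge e))) , isTree (Spanning.tree S)) , stem)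
  -- Any spanning tree starts the induction, its own excess providing the bound.
  (suc (excess T)) S ≤-refl
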